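{- For $m\ge1$, the graphs $X_{3m}$ form an infinite family of vertex-transitive 3-RDR graphs, $X_{3m}$ having order $36m$, and no $X_{3m}$ is isomorphic to a honeycomb toroidal graph or to a generalized Petersen graph.
   Context: Definition of $X_n$, $n\ge 3$: let $D_n=\langle r,z\mid r^n=z^2=(zr)^2=1\rangle$ be the dihedral group of order $2n$, let $S_3$ be the symmetric group on $\{1,2,3\}$, and let $G=S_3\times D_n$. Put $a=((1\,2),1)$, $b=((1\,3),z)$, $c=((2\,3),zr)$ and $S=\{a,b,c\}$. Then $X_n=\mathrm{Cay}(G,S)$ is the graph with vertex set $G$ and edge set $\{\{g,gs\}: g\in G, s\in S\}$. All graphs are finite and simple. For a graph with vertex set $V$, $N(v)$ is the open neighbourhood of $v$. A $3$-rainbow dominating function (3-RDF) is a map $f\colon V\to 2^{\{1,2,3\}}$ such that $f(v)=\emptyset$ implies $\bigcup_{u\in N(v)}f(u)=\{1,2,3\}$, for all $v\in V$; $\gamma_{r3}$ is the minimum of $\sum_{v}|f(v)|$ over all 3-RDFs. A cubic (3-regular) graph is 3-RDR (3-rainbow domination regular) if $\gamma_{r3}=|V|/2$ (the known lower bound for cubic graphs). For $1\le k\le n/2$, the generalized Petersen graph $\mathrm{GP}(n,k)$ has vertex set $\{u_i,v_i: i\in\mathbb Z_n\}$ and edges $\{u_i,u_{i+1}\}$, $\{u_i,v_i\}$, $\{v_i,v_{i+k}\}$, $i\in\mathbb Z_n$. For integers $m\ge1$, even $n\ge4$, and $0\le\ell\le n/2$ with $\ell\equiv m\pmod 2$, the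 honeycomb toroidal graph $\mathrm{HTG}(m,n,\ell)$ has vertex set $\{v_{i,j}: i\in\mathbb Z_m, j\in\mathbb Z_n\}$ and edge set the disjoint union of: vertical edges $\{v_{i,j},v_{i,j+1}\}$ for $i\in\mathbb Z_m$, $j\in\mathbb Z_n$; horizontal edges $\{v_{i,j},v_{i+1,j}\}$ for $i\in\mathbb Z_m\setminus\{m-1\}$, $j\in\mathbb Z_n$, $i+1\equiv j\pmod 2$; and jumps $\{v_{m-1,j},v_{0,j+\ell}\}$ for $j\in\mathbb Z_n$, $j\equiv m\pmod 2$. -}

module Defs where

open import Level using (0ℓ)
open import Algebra.Bundles using (Group)
open import Algebra.Construct.DirectProduct using () renaming (group to _×ᴳ_)
import Algebra.Properties.CommutativeMonoid.Sum as Sum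
open import Data.Fin using (Fin; toℕ; #_)
open import Data.Fin.Permutation using (Permutation′; _⟨$⟩ʳ_; _⟨$⟩ˡ_; _∘ₚ_; flip; transpose; inverseˡ; inverseʳ)
  renaming (id to idₚ; _≈_ to _≈ₚ_)
open import Data.Fin.Properties using (nonZeroIndex)
open import Data.Fin.Subset using (Subset; ∣_∣; ⊥) renaming (_∈_ to _∈ˢ_)
open import Data.List using (List; []; _∷_)
open import Data.List.Membership.Propositional using (_∈_)
open import Data.Nat using (ℕ; zero; suc; _+_; _*_; _≤_)
open import Data.Nat.DivMod using (_%_; _mod_)
open import Data.Nat.Properties using (+-0-commutativeMonoid)
open import Data.Product using (Σ-syntax; ∃-syntax; _×_; _,_; proj₁; proj₂)
open import Data.Sum using (_⊎_; inj₁; inj₂)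
open import Function.Bundles using (Func; Inverse; _⇔_)
open import Relation.Binary.Bundles using (Setoid)
import Relation.Binary.Construct.On as On
open import Relation.Binary.PropositionalEquality using (_≡_; refl; sym; trans; cong)
import Relation.Binary.PropositionalEquality as ≡
open import Relation.Nullary using (¬_)

HasCardinality : Setoid 0ℓ 0ℓ → ℕ → Set
HasCardinality A k = Inverse (≡.setoid (Fin k)) A

-- The vertices form a setoid because the vertex set of a Cayley graph is the
-- carrier of a group, which is given up to the group's equality.
record Graph : Set₁ where
  infix 4 _~_
  field
    vertices : Setoid 0ℓ 0ℓ
  open Setoid vertices public using () renaming (Carrier to V; _≈_ to _≈ᵛ_)
  field
    _~_      : V → V → Set
    ~-resp   : ∀ {x x′ y y′} → x ≈ᵛ x′ → y ≈ᵛ y′ → x ~ y → x′ ~ y′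
    ~-sym    : ∀ {x y} → x ~ y → y ~ x
    ~-irrefl : ∀ {x y} → x ≈ᵛ y → ¬ x ~ y

  N : V → Setoid 0ℓ 0ℓ
  N v = On.setoid {B = Σ[ u ∈ V ] v ~ u} vertices proj₁

-- The simple graph with edge set { {p , q} : (p , q) = endpoints e, e ∈ E }.
-- Coinciding edges are identified and loops (p = q) are dropped.
fromEdges : (A : Setoid 0ℓ 0ℓ) {E : Set} →
            (E → Setoid.Carrier A × Setoid.Carrier A) → Graph
fromEdges A {E} endpoints = record
  { vertices = A
  ; _~_      = λ x y → ¬ (x ≈ y) × ∃[ e ] Joins e x y
  ; ~-resp   = λ x≈x′ y≈y′ (x≉y , e , j) →
      (λ x′≈y′ → x≉y (A.trans x≈x′ (A.trans x′≈y′ (A.sym y≈y′)))) , e , resp x≈x′ y≈y′ j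
  ; ~-sym    = λ (x≉y , e , j) → (λ y≈x → x≉y (A.sym y≈x)) , e , swap j
  ; ~-irrefl = λ x≈y (x≉y , _) → x≉y x≈y
  }
  where
  module A = Setoid A
  open A using (_≈_)

  Joins : E → A.Carrier → A.Carrier → Set
  Joins e x y = let (p , q) = endpoints e in (x ≈ p × y ≈ q) ⊎ (x ≈ q × y ≈ p)

  resp : ∀ {e x x′ y y′} → x ≈ x′ → y ≈ y′ → Joins e x y → Joins e x′ y′
  resp s t (inj₁ (a , b)) = inj₁ (A.trans (A.sym s) a , A.trans (A.sym t) b)
  resp s t (inj₂ (a , b)) = inj₂ (A.trans (A.sym s) a , A.trans (A.sym t) b)

  swap : ∀ {e x y} → Joins e x y → Joins e y x
  swap (inj₁ (a , b)) = inj₂ (b , a)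
  swap (inj₂ (a , b)) = inj₁ (b , a)

infix 4 _≅_

record _≅_ (G H : Graph) : Set where
  private
    module G = Graph G
    module H = Graph H
  field
    bijection : Inverse G.vertices H.vertices
  open Inverse bijection public using (to; from)
  field
    adjacency : ∀ x y → x G.~ y ⇔ to x H.~ to y

VertexTransitive : Graph → Set
VertexTransitive G = ∀ x y → Σ[ φ ∈ G ≅ G ] _≅_.to φ x ≈ᵛ y
  where open Graph G

HasOrder : Graph → ℕ → Set
HasOrder G = HasCardinality (Graph.vertices G)

IsCubic : Graph → Set
IsCubic G = ∀ v → HasCardinality (Graph.N G v) 3

module _ (G : Graph) where
  open Graph G

  Labelling : Set
  Labelling = Func vertices (≡.setoid (Subset 3))

  Is3RDF : Labelling → Set
  Is3RDF f = ∀ v → Func.to f v ≡ ⊥ → ∀ c → ∃[ u ] v ~ u × c ∈ˢ Func.to f u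

  -- The sum over all vertices, taken along an enumeration of them.
  weight : ∀ {k} → HasOrder G k → Labelling → ℕ
  weight enum f = sum λ i → ∣ Func.to f (Inverse.to enum i) ∣
    where open Sum +-0-commutativeMonoid using (sum)

  IsRainbowDominationNumber : ∀ {k} → HasOrder G k → ℕ → Set
  IsRainbowDominationNumber enum γ =
      (∃[ f ] Is3RDF f × weight enum f ≡ γ)
    × (∀ f → Is3RDF f → γ ≤ weight enum f)

Is3RDR : Graph → Set
Is3RDR G =
    IsCubic G
  × ∃[ k ] Σ[ enum ∈ HasOrder G k ] ∃[ γ ]
      IsRainbowDominationNumber G enum γ × 2 * γ ≡ k

-- The group ⟨ A ∣ w = 1 for every w with R w ⟩: group words over A modulo the
-- least congruence that satisfies the group laws and kills the relators.
module Presentation (A : Set) where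

  infixl 7 _∙_
  infix  8 _⁻¹ _^_

  data Word : Set where
    gen : A → Word
    ε   : Word
    _∙_ : Word → Word → Word
    _⁻¹ : Word → Word

  _^_ : Word → ℕ → Word
  w ^ zero  = ε
  w ^ suc k = w ∙ w ^ k

  module _ (R : Word → Set) where
    infix 4 _≈_

    data _≈_ : Word → Word → Set where
      ≈-refl  : ∀ {x} → x ≈ x
      ≈-sym   : ∀ {x y} → x ≈ y → y ≈ x
      ≈-trans : ∀ {x y z} → x ≈ y → y ≈ z → x ≈ z
      ∙-cong  : ∀ {x x′ y y′} → x ≈ x′ → y ≈ y′ → x ∙ y ≈ x′ ∙ y′
      ⁻¹-cong : ∀ {x x′} → x ≈ x′ → x ⁻¹ ≈ x′ ⁻¹
      assoc   : ∀ x y z → (x ∙ y) ∙ z ≈ x ∙ (y ∙ z)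
      idˡ     : ∀ x → ε ∙ x ≈ x
      idʳ     : ∀ x → x ∙ ε ≈ x
      invˡ    : ∀ x → x ⁻¹ ∙ x ≈ ε
      invʳ    : ∀ x → x ∙ x ⁻¹ ≈ ε
      relator : ∀ {w} → R w → w ≈ ε

    presentedGroup : Group 0ℓ 0ℓ
    presentedGroup = record
      { Carrier = Word
      ; _≈_     = _≈_
      ; _∙_     = _∙_
      ; ε       = ε
      ; _⁻¹     = _⁻¹
      ; isGroup = record
        { isMonoid = record
          { isSemigroup = record
            { isMagma = record
              { isEquivalence = record { refl = ≈-refl ; sym = ≈-sym ; trans = ≈-trans }
              ; ∙-cong        = ∙-cong
              }
            ; assoc = assoc
            }
          ; identity = idˡ , idʳ
          }
        ; inverse = invˡ , invʳ
        ; ⁻¹-cong = ⁻¹-cong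
        }
      }

data DihedralGen : Set where
  r z : DihedralGen

open Presentation DihedralGen using (Word; gen; _^_)

-- These words are shared by all D n; only their equality depends on n.
rᴰ zᴰ zrᴰ : Word
rᴰ  = gen r
zᴰ  = gen z
zrᴰ = zᴰ Presentation.∙ rᴰ

data DihedralRelator (n : ℕ) : Word → Set where
  rⁿ  : DihedralRelator n (rᴰ ^ n)
  z²  : DihedralRelator n (zᴰ ^ 2)
  zr² : DihedralRelator n (zrᴰ ^ 2)

D : ℕ → Group 0ℓ 0ℓ
D n = Presentation.presentedGroup DihedralGen (DihedralRelator n)

-- Products are composed right to left: (σ τ)(i) = σ(τ(i)), whereas _∘ₚ_
-- applies its left argument first.
symmetricGroup : ℕ → Group 0ℓ 0ℓ
symmetricGroup n = record
  { Carrier = Permutation′ n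
  ; _≈_     = _≈ₚ_
  ; _∙_     = λ σ τ → τ ∘ₚ σ
  ; ε       = idₚ
  ; _⁻¹     = flip
  ; isGroup = record
    { isMonoid = record
      { isSemigroup = record
        { isMagma = record
          { isEquivalence = record
            { refl  = λ _ → refl
            ; sym   = λ p i → sym (p i)
            ; trans = λ p q i → trans (p i) (q i)
            }
          ; ∙-cong = λ {σ} {_} {_} {τ′} p q i → trans (cong (σ ⟨$⟩ʳ_) (q i)) (p (τ′ ⟨$⟩ʳ i))
          }
        ; assoc = λ _ _ _ _ → refl
        }
      ; identity = (λ _ _ → refl) , (λ _ _ → refl)
      }
    ; inverse = (λ σ i → inverseˡ σ) , (λ σ i → inverseʳ σ)
    ; ⁻¹-cong = λ {σ} {τ} p i →
        trans (cong (σ ⟨$⟩ˡ_) (sym (trans (p (τ ⟨$⟩ˡ i)) (inverseʳ τ)))) (inverseˡ σ)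
    }
  }

Cay : (G : Group 0ℓ 0ℓ) → List (Group.Carrier G) → Graph
Cay G S = fromEdges (Group.setoid G) {Group.Carrier G × ∃[ s ] s ∈ S}
  λ (g , s , _) → g , Group._∙_ G g s

-- S₃ permutes the points 0, 1, 2 of Fin 3 instead of 1, 2, 3.
X : ℕ → Graph
X n = Cay G (a ∷ b ∷ c ∷ [])
  where
  G : Group 0ℓ 0ℓ
  G = symmetricGroup 3 ×ᴳ D n

  a b c : Group.Carrier G
  a = transpose (# 0) (# 1) , Group.ε (D n)
  b = transpose (# 0) (# 2) , zᴰ
  c = transpose (# 1) (# 2) , zrᴰ

infixl 6 _⊕_

-- i ⊕ k is i + k in ℤₙ.
_⊕_ : ∀ {n} → Fin n → ℕ → Fin n
_⊕_ {n} i k = _mod_ (toℕ i + k) n ⦃ nonZeroIndex i ⦄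

data GPVertex (n : ℕ) : Set where
  u v : Fin n → GPVertex n

data GPEdge (n : ℕ) : Set where
  outer spoke inner : Fin n → GPEdge n

-- Meant for 1 ≤ k ≤ n / 2.
GP : (n k : ℕ) → Graph
GP n k = fromEdges (≡.setoid (GPVertex n)) endpoints
  where
  endpoints : GPEdge n → GPVertex n × GPVertex n
  endpoints (outer i) = u i , u (i ⊕ 1)
  endpoints (spoke i) = u i , v i
  endpoints (inner i) = v i , v (i ⊕ k)

infix 4 _≡₂_

_≡₂_ : ℕ → ℕ → Set
i ≡₂ j = i % 2 ≡ j % 2

data HTGEdge (m n : ℕ) : Set where
  vertical   : Fin m → Fin n → HTGEdge m n
  horizontal : (i i′ : Fin m) (j : Fin n) → toℕ i′ ≡ toℕ i + 1 →
               toℕ i + 1 ≡₂ toℕ j → HTGEdge m n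
  jump       : (last first : Fin m) (j : Fin n) → toℕ last + 1 ≡ m → toℕ first ≡ 0 →
               toℕ j ≡₂ m → HTGEdge m n

-- Meant for m ≥ 1, even n ≥ 4, ℓ ≤ n / 2 and ℓ ≡₂ m.
HTG : (m n ℓ : ℕ) → Graph
HTG m n ℓ = fromEdges (≡.setoid (Fin m × Fin n)) endpoints
  where
  endpoints : HTGEdge m n → (Fin m × Fin n) × (Fin m × Fin n)
  endpoints (vertical i j)              = (i , j) , (i , j ⊕ 1)
  endpoints (horizontal i i′ j _ _)     = (i , j) , (i′ , j)
  endpoints (jump last first j _ _ _)   = (last , j) , (first , j ⊕ ℓ)

{-# OPTIONS --safe #-}

-- Colouring every edge of X n by its generator turns a closed walk into a word
-- in a, b, c that is trivial in S₃ × Dₙ.  For n = 3m such a word is also trivial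
-- in S₃ × D₃, where a finite search applies.
--
-- Rainbow domination: giving weight 3 to each vertex and 1 to each neighbour,
-- every vertex receives at least 3 from a 3-RDF, whence γ ≥ |V| / 2.  Equality is
-- attained by f(σ , d) = ∅ for odd σ and f(σ , d) = {d · 2} for even σ, where D₃ₘ
-- acts on ℤ₃, because 1, z and zr send 2 to different points.
--
-- Honeycomb toroidal graphs: closed reduced words of length 6 avoid a, so no
-- hexagon of X n contains an edge coloured a.  In a honeycomb toroidal graph
-- every edge at a suitable vertex lies on a hexagon, unless m = ℓ = 1, when the
-- graph is a cycle.
--
-- Generalized Petersen graphs: the 8-cycles uᵢuᵢ₊₁vᵢ₊₁vᵢ₊₁₊ₖuᵢ₊₁₊ₖuᵢ₊ₖvᵢ₊ₖvᵢ, for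
-- four indices i, i + 1, i + k, i + 1 + k, force all spokes to be coloured a.  Then
-- the outer cycle alternates between b and c and closes up after 6m steps because
-- bc has order 3m, but it has length |V| / 2 = 18m.

module Submission where

open import Defs
open import Algebra.Bundles using (Group)
open import Algebra.Construct.DirectProduct using () renaming (group to _×ᴳ_)
import Algebra.Properties.CommutativeMonoid.Sum as Sum
open import Data.Bool using (Bool; true; false; not)
import Data.Bool.Properties as Bool
open import Data.Empty using () renaming (⊥ to Empty)
open import Data.Fin using (Fin; zero; suc; toℕ; fromℕ<)
open import Data.Fin.Patterns using (0F; 1F; 2F; 3F; 4F; 5F; 7F)
open import Data.Fin.Permutation using (Permutation′; _⟨$⟩ʳ_; _⟨$⟩ˡ_; _∘ₚ_; transpose; inverseˡ; inverseʳ; ↔⇒≡)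
  renaming (id to idₚ)
open import Data.Fin.Properties using (_≟_; all?; nonZeroIndex; toℕ-injective; toℕ-fromℕ<; toℕ<n; *↔×; +↔⊎)
open import Data.Fin.Subset using (Subset; ∣_∣; ⊥; ⊤; _∪_; ⁅_⁆) renaming (_∈_ to _∈ˢ_)
open import Data.Fin.Subset.Properties using (∣⊤∣≡n; p⊆q⇒∣p∣≤∣q∣; x∈p∪q⁺; ∉⊥; x∈⁅x⁆; ∣⁅x⁆∣≡1)
open import Data.List using (List; []; _∷_)
open import Data.List.Membership.Propositional using (_∈_)
open import Data.List.Relation.Unary.Any using (here; there)
open import Data.Nat using (ℕ; zero; suc; _+_; _*_; _∸_; _≤_; _<_; z≤n; s≤s; NonZero; >-nonZero)
open import Data.Nat.Divisibility using (_∣_; m∣m*n; ∣-refl; divides; >⇒∤)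
open import Data.Nat.DivMod using (_%_; _/_; m≡m%n+[m/n]*n; %-remove-+ʳ; m<n⇒m%n≡m; %-distribˡ-+; m%n%n≡m%n; m∣n⇒o%n%m≡o%m)
open import Data.Nat.Properties hiding (_≟_)
open import Data.Nat.Tactic.RingSolver using (solve-∀)
open import Data.Product using (∃-syntax; _×_; _,_; proj₁; proj₂)
open import Data.Product.Properties using (,-injectiveʳ)
open import Data.Product.Relation.Binary.Pointwise.NonDependent using (×-setoid)
open import Data.Sum using (_⊎_; inj₁; inj₂)
open import Data.Vec using (Vec; []; _∷_; foldr′; lookup)
open import Data.Vec.Relation.Unary.All as All using (All; []; _∷_)
open import Data.Vec.Relation.Unary.Linked using (Linked; []; [-]; _∷_)
open import Function using (_∘_)
open import Function.Bundles using (Func; Inverse; Equivalence; _↔_; mk↔ₛ′; mk⇔)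
import Function.Construct.Composition as Composition
open Composition using (_↔-∘_)
open import Function.Construct.Identity using (↔-id)
open import Function.Construct.Symmetry using (↔-sym)
open import Relation.Binary.Bundles using (Setoid)
open import Relation.Binary.PropositionalEquality using (_≡_; _≢_; refl; sym; trans; cong; cong₂; subst; module ≡-Reasoning)
import Relation.Binary.PropositionalEquality as ≡
open import Relation.Nullary using (¬_; Dec; does; ¬?; _→-dec_; _×-dec_; _⊎-dec_; contradiction)
open import Relation.Nullary.Decidable using (from-yes; map′)
open Sum +-0-commutativeMonoid using (sum; sum-cong-≗; ∑-distrib-+; sum-permute)

-- Arithmetic in ℤₙ and cardinalities

toℕ-⊕ : ∀ {n} (i : Fin n) k → toℕ (i ⊕ k) ≡ _%_ (toℕ i + k) n ⦃ nonZeroIndex i ⦄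
toℕ-⊕ {suc _} i k = toℕ-fromℕ< _

⊕-assoc : ∀ {n} (i : Fin n) j k → (i ⊕ j) ⊕ k ≡ i ⊕ (j + k)
⊕-assoc {n@(suc _)} i j k = toℕ-injective (begin
  toℕ ((i ⊕ j) ⊕ k)                  ≡⟨ toℕ-⊕ (i ⊕ j) k ⟩
  (toℕ (i ⊕ j) + k) % n              ≡⟨ cong (λ t → (t + k) % n) (toℕ-⊕ i j) ⟩
  ((toℕ i + j) % n + k) % n          ≡⟨ %-distribˡ-+ ((toℕ i + j) % n) k n ⟩
  ((toℕ i + j) % n % n + k % n) % n  ≡⟨ cong (λ t → (t + k % n) % n) (m%n%n≡m%n (toℕ i + j) n) ⟩
  ((toℕ i + j) % n + k % n) % n      ≡⟨ %-distribˡ-+ (toℕ i + j) k n ⟨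
  (toℕ i + j + k) % n                ≡⟨ cong (_% n) (+-assoc (toℕ i) j k) ⟩
  (toℕ i + (j + k)) % n              ≡⟨ toℕ-⊕ i (j + k) ⟨
  toℕ (i ⊕ (j + k))                  ∎)
  where open ≡-Reasoning

⊕-multiple : ∀ {n} (i : Fin n) {k} → n ∣ k → i ⊕ k ≡ i
⊕-multiple {n@(suc _)} i {k} n∣k = toℕ-injective (begin
  toℕ (i ⊕ k)      ≡⟨ toℕ-⊕ i k ⟩
  (toℕ i + k) % n  ≡⟨ %-remove-+ʳ (toℕ i) n∣k ⟩
  toℕ i % n        ≡⟨ m<n⇒m%n≡m (toℕ<n i) ⟩
  toℕ i            ∎)
  where open ≡-Reasoning

⊕-fixed : ∀ {n} (i : Fin n) {k} → i ⊕ k ≡ i → n ∣ k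
⊕-fixed {n@(suc _)} i {k} eq = divides ((toℕ i + k) / n) (+-cancelˡ-≡ (toℕ i) _ _ (begin
  toℕ i + k                              ≡⟨ m≡m%n+[m/n]*n (toℕ i + k) n ⟩
  (toℕ i + k) % n + (toℕ i + k) / n * n  ≡⟨ cong (_+ (toℕ i + k) / n * n) (trans (sym (toℕ-⊕ i k)) (cong toℕ eq)) ⟩
  toℕ i + (toℕ i + k) / n * n            ∎))
  where open ≡-Reasoning

⊕-moves : ∀ {n} (i : Fin n) {k} → 0 < k → k < n → i ⊕ k ≢ i
⊕-moves i 0<k k<n eq = >⇒∤ ⦃ >-nonZero 0<k ⦄ k<n (⊕-fixed i eq)

×-cardinality : ∀ {A B j k} → HasCardinality A j → HasCardinality B k →
                HasCardinality (×-setoid A B) (j * k)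
×-cardinality {A} {B} {j} {k} I J = record
  { to        = λ i → let (p , q) = P.to i in I.to p , J.to q
  ; from      = λ (x , y) → P.from (I.from x , J.from y)
  ; to-cong   = λ { refl → A.refl , B.refl }
  ; from-cong = λ (x≈x′ , y≈y′) → cong₂ (λ p q → P.from (p , q)) (I.from-cong x≈x′) (J.from-cong y≈y′)
  ; inverse   =
      (λ { refl → subst (λ r → I.to (proj₁ r) A.≈ _) (sym (P.strictlyInverseˡ _)) (I.strictlyInverseˡ _)
                , subst (λ r → J.to (proj₂ r) B.≈ _) (sym (P.strictlyInverseˡ _)) (J.strictlyInverseˡ _) })
    , (λ (x≈ , y≈) → trans (cong₂ (λ p q → P.from (p , q)) (I.inverseʳ x≈) (J.inverseʳ y≈)) (P.strictlyInverseʳ _))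
  }
  where
  module A = Setoid A
  module B = Setoid B
  module I = Inverse I
  module J = Inverse J
  module P = Inverse (*↔× {j} {k})

-- Actions of presented groups

module Act {A T : Set} (α : A → T ↔ T) where
  open Presentation A

  action : Word → T ↔ T
  action (gen x) = α x
  action ε       = ↔-id T
  action (x ∙ y) = action x ↔-∘ action y
  action (x ⁻¹)  = ↔-sym (action x)

  infixr 7 _·_

  _·_ : Word → T → T
  w · t = Inverse.to (action w) t

  ·-injective : ∀ w {s t} → w · s ≡ w · t → s ≡ t
  ·-injective w eq = trans (sym (Inverse.strictlyInverseʳ (action w) _))
    (trans (cong (Inverse.from (action w)) eq) (Inverse.strictlyInverseʳ (action w) _))

  module _ {R : Word → Set} (relator-trivial : ∀ {w} → R w → ∀ t → w · t ≡ t) where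

    -- Equality in a presented group is generated by its rules, so induction on a derivation leaves
    -- only the relators to be checked on `T`. Consequently words that act differently are different
    -- elements, which is how they are told apart below.
    ·-resp-≈ : ∀ {x y} → _≈_ R x y → ∀ t → x · t ≡ y · t
    ·-resp-≈ ≈-refl                         t = refl
    ·-resp-≈ (≈-sym p)                      t = sym (·-resp-≈ p t)
    ·-resp-≈ (≈-trans p q)                  t = trans (·-resp-≈ p t) (·-resp-≈ q t)
    ·-resp-≈ (∙-cong {x} {x′} {y} {y′} p q) t = trans (cong (x ·_) (·-resp-≈ q t)) (·-resp-≈ p (y′ · t))
    ·-resp-≈ (⁻¹-cong {x} {x′} p)           t = ·-injective x (begin
      x · x ⁻¹ · t    ≡⟨ Inverse.strictlyInverseˡ (action x) t ⟩
      t               ≡⟨ Inverse.strictlyInverseˡ (action x′) t ⟨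
      x′ · x′ ⁻¹ · t  ≡⟨ ·-resp-≈ p (x′ ⁻¹ · t) ⟨
      x · x′ ⁻¹ · t   ∎)
      where open ≡-Reasoning
    ·-resp-≈ (assoc _ _ _)                  t = refl
    ·-resp-≈ (idˡ _)                        t = refl
    ·-resp-≈ (idʳ _)                        t = refl
    ·-resp-≈ (invˡ x)                       t = Inverse.strictlyInverseʳ (action x) t
    ·-resp-≈ (invʳ x)                       t = Inverse.strictlyInverseˡ (action x) t
    ·-resp-≈ (relator p)                    t = relator-trivial p t

module _ {A : Set} {R : Presentation.Word A → Set} where
  open Presentation A
  private
    _≈ᴿ_ = _≈_ R
    infix 4 _≈ᴿ_

  open Group (presentedGroup R) using () renaming (∙-congˡ to congˡ; ∙-congʳ to congʳ)

  ^-+ : ∀ w j k → w ^ (j + k) ≈ᴿ w ^ j ∙ w ^ k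
  ^-+ w zero    k = ≈-sym (idˡ _)
  ^-+ w (suc j) k = ≈-trans (congˡ (^-+ w j k)) (≈-sym (assoc _ _ _))

  ^-multiple : ∀ w {n} q → w ^ n ≈ᴿ ε → w ^ (q * n) ≈ᴿ ε
  ^-multiple w zero    wⁿ = ≈-refl
  ^-multiple w {n} (suc q) wⁿ = ≈-trans (^-+ w n (q * n))
    (≈-trans (∙-cong wⁿ (^-multiple w q wⁿ)) (idˡ ε))

  ^-% : ∀ w k n .{{_ : NonZero n}} → w ^ n ≈ᴿ ε → w ^ (k % n) ≈ᴿ w ^ k
  ^-% w k n wⁿ = begin
    w ^ (k % n)                   ≈⟨ idʳ _ ⟨
    w ^ (k % n) ∙ ε               ≈⟨ congˡ (^-multiple w (k / n) wⁿ) ⟨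
    w ^ (k % n) ∙ w ^ (k / n * n) ≈⟨ ^-+ w (k % n) (k / n * n) ⟨
    w ^ (k % n + k / n * n)       ≡⟨ cong (w ^_) (m≡m%n+[m/n]*n k n) ⟨
    w ^ k                         ∎
    where open import Relation.Binary.Reasoning.Setoid (Group.setoid (presentedGroup R))

-- Normal forms in the dihedral group

module Dihedral (p : ℕ) where

  open Presentation DihedralGen
  open Group (D (suc p)) using () renaming (∙-congˡ to congˡ; ∙-congʳ to congʳ; setoid to Dₙ)
  open import Relation.Binary.Reasoning.Setoid Dₙ
  private
    n = suc p
    _≈ᴰ_ = _≈_ (DihedralRelator n)
    infix 4 _≈ᴰ_

  -- (e , k) stands for the element zᵉrᵏ.
  NormalForm : Set
  NormalForm = Fin 2 × Fin n

  -- From `rz = zr⁻¹`, left multiplication by `r` lowers the exponent behind a `z`. As `n = p + 1`,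
  -- lowering by one in ℤₙ is `⊕ p`.
  leftMultiplication : DihedralGen → NormalForm ↔ NormalForm
  leftMultiplication r = mk↔ₛ′
    (λ { (0F , k) → 0F , k ⊕ 1 ; (1F , k) → 1F , k ⊕ p })
    (λ { (0F , k) → 0F , k ⊕ p ; (1F , k) → 1F , k ⊕ 1 })
    (λ { (0F , k) → cong (0F ,_) (p+1 k) ; (1F , k) → cong (1F ,_) (1+p k) })
    (λ { (0F , k) → cong (0F ,_) (1+p k) ; (1F , k) → cong (1F ,_) (p+1 k) })
    where
    1+p : ∀ (k : Fin n) → (k ⊕ 1) ⊕ p ≡ k
    1+p k = trans (⊕-assoc k 1 p) (⊕-multiple k ∣-refl)
    p+1 : ∀ (k : Fin n) → (k ⊕ p) ⊕ 1 ≡ k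
    p+1 k = trans (⊕-assoc k p 1) (⊕-multiple k (subst (n ∣_) (+-comm 1 p) ∣-refl))
  leftMultiplication z = mk↔ₛ′ swap swap
    (λ { (0F , k) → refl ; (1F , k) → refl })
    (λ { (0F , k) → refl ; (1F , k) → refl })
    where
    swap : NormalForm → NormalForm
    swap (0F , k) = 1F , k
    swap (1F , k) = 0F , k

  open Act leftMultiplication

  rʲ·rᵏ : ∀ j k → rᴰ ^ j · (0F , k) ≡ (0F , k ⊕ j)
  rʲ·rᵏ zero    k = cong (0F ,_) (sym (⊕-multiple k (divides 0 refl)))
  rʲ·rᵏ (suc j) k = trans (cong (rᴰ ·_) (rʲ·rᵏ j k))
    (cong (0F ,_) (trans (⊕-assoc k j 1) (cong (k ⊕_) (+-comm j 1))))

  rʲ·zrᵏ : ∀ j k → rᴰ ^ j · (1F , k) ≡ (1F , k ⊕ (j * p))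
  rʲ·zrᵏ zero    k = cong (1F ,_) (sym (⊕-multiple k (divides 0 refl)))
  rʲ·zrᵏ (suc j) k = trans (cong (rᴰ ·_) (rʲ·zrᵏ j k))
    (cong (1F ,_) (trans (⊕-assoc k (j * p) p) (cong (k ⊕_) (+-comm (j * p) p))))

  relator-trivial : ∀ {w} → DihedralRelator n w → ∀ t → w · t ≡ t
  relator-trivial rⁿ  (0F , k) = trans (rʲ·rᵏ n k) (cong (0F ,_) (⊕-multiple k ∣-refl))
  relator-trivial rⁿ  (1F , k) = trans (rʲ·zrᵏ n k) (cong (1F ,_) (⊕-multiple k (m∣m*n p)))
  relator-trivial z²  (0F , k) = refl
  relator-trivial z²  (1F , k) = refl
  -- Conjugation by `z` turns the action of `r` into its inverse, so `zrzr` acts as `r⁻¹` after `r`.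
  relator-trivial zr² (0F , k) = Inverse.strictlyInverseʳ (leftMultiplication r) (0F , k)
  relator-trivial zr² (1F , k) = Inverse.strictlyInverseʳ (leftMultiplication r) (1F , k)

  normalForm : Word → NormalForm
  normalForm w = w · (0F , 0F)

  word : NormalForm → Word
  word (0F , k) = rᴰ ^ toℕ k
  word (1F , k) = zᴰ ∙ rᴰ ^ toℕ k

  r^⊕ : ∀ (k : Fin n) j → rᴰ ^ toℕ (k ⊕ j) ≈ᴰ rᴰ ^ (j + toℕ k)
  r^⊕ k j = begin
    rᴰ ^ toℕ (k ⊕ j)        ≡⟨ cong (rᴰ ^_) (toℕ-⊕ k j) ⟩
    rᴰ ^ ((toℕ k + j) % n)  ≈⟨ ^-% rᴰ (toℕ k + j) n (relator rⁿ) ⟩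
    rᴰ ^ (toℕ k + j)        ≡⟨ cong (rᴰ ^_) (+-comm (toℕ k) j) ⟩
    rᴰ ^ (j + toℕ k)        ∎

  zz : zᴰ ∙ zᴰ ≈ᴰ ε
  zz = ≈-trans (congˡ (≈-sym (idʳ _))) (relator z²)

  z∙z∙ : ∀ w → zᴰ ∙ (zᴰ ∙ w) ≈ᴰ w
  z∙z∙ w = ≈-trans (≈-sym (assoc _ _ _)) (≈-trans (congʳ zz) (idˡ w))

  rzr : rᴰ ∙ (zᴰ ∙ rᴰ) ≈ᴰ zᴰ
  rzr = begin
    rᴰ ∙ (zᴰ ∙ rᴰ)                ≈⟨ z∙z∙ _ ⟨
    zᴰ ∙ (zᴰ ∙ (rᴰ ∙ (zᴰ ∙ rᴰ)))  ≈⟨ congˡ (assoc _ _ _) ⟨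
    zᴰ ∙ (zrᴰ ∙ zrᴰ)              ≈⟨ congˡ (congˡ (idʳ _)) ⟨
    zᴰ ∙ (zrᴰ ^ 2)                ≈⟨ congˡ (relator zr²) ⟩
    zᴰ ∙ ε                        ≈⟨ idʳ _ ⟩
    zᴰ                            ∎

  -- Taken at the normal form of `ε`, this rewrites an arbitrary word into normal form. Among the
  -- generators, only `r` in front of `zrᵏ` takes real work, by way of `rzr`.
  word-· : ∀ w t → word (w · t) ≈ᴰ w ∙ word t
  word-· (gen r) (0F , k) = r^⊕ k 1
  word-· (gen r) (1F , k) = begin
    zᴰ ∙ rᴰ ^ toℕ (k ⊕ p)                ≈⟨ congˡ (r^⊕ k p) ⟩
    -- Replacing `z` by `r(zr)` supplies the factor that completes `rᵖ` to `rⁿ`.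
    zᴰ ∙ rᴰ ^ (p + toℕ k)                ≈⟨ congʳ rzr ⟨
    rᴰ ∙ (zᴰ ∙ rᴰ) ∙ rᴰ ^ (p + toℕ k)    ≈⟨ ≈-trans (assoc _ _ _) (congˡ (assoc _ _ _)) ⟩
    rᴰ ∙ (zᴰ ∙ (rᴰ ^ (n + toℕ k)))       ≈⟨ congˡ (congˡ (≈-trans (^-+ rᴰ n (toℕ k)) (congʳ (relator rⁿ)))) ⟩
    rᴰ ∙ (zᴰ ∙ (ε ∙ rᴰ ^ toℕ k))         ≈⟨ congˡ (congˡ (idˡ _)) ⟩
    rᴰ ∙ (zᴰ ∙ rᴰ ^ toℕ k)               ∎
  word-· (gen z) (0F , k) = ≈-refl
  word-· (gen z) (1F , k) = ≈-sym (z∙z∙ _)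
  word-· ε       t        = ≈-sym (idˡ _)
  word-· (x ∙ w) t        = ≈-trans (word-· x (w · t)) (≈-trans (congˡ (word-· w t)) (≈-sym (assoc _ _ _)))
  word-· (w ⁻¹)  t        = begin
    word (w ⁻¹ · t)               ≈⟨ idˡ _ ⟨
    ε ∙ word (w ⁻¹ · t)           ≈⟨ congʳ (invˡ w) ⟨
    w ⁻¹ ∙ w ∙ word (w ⁻¹ · t)    ≈⟨ assoc _ _ _ ⟩
    w ⁻¹ ∙ (w ∙ word (w ⁻¹ · t))  ≈⟨ congˡ (word-· w (w ⁻¹ · t)) ⟨
    w ⁻¹ ∙ word (w · w ⁻¹ · t)    ≡⟨ cong (λ s → w ⁻¹ ∙ word s) (Inverse.strictlyInverseˡ (action w) t) ⟩
    w ⁻¹ ∙ word t                 ∎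

  word-normalForm : ∀ w → word (normalForm w) ≈ᴰ w
  word-normalForm w = ≈-trans (word-· w _) (idʳ w)

  normalForm-word : ∀ t → normalForm (word t) ≡ t
  normalForm-word (0F , k) = trans (rʲ·rᵏ (toℕ k) 0F) (cong (0F ,_)
    (toℕ-injective (trans (toℕ-⊕ 0F (toℕ k)) (m<n⇒m%n≡m (toℕ<n k)))))
  normalForm-word (1F , k) = cong (zᴰ ·_) (normalForm-word (0F , k))

  -- The normal forms exhaust the group by `word-normalForm`, and the action on normal forms keeps
  -- them distinct by `normalForm-word`.
  cardinality : HasCardinality (Group.setoid (D n)) (2 * n)
  cardinality = record
    { to        = word ∘ P.to
    ; from      = P.from ∘ normalForm
    ; to-cong   = λ { refl → ≈-refl }
    ; from-cong = λ v≈w → cong P.from (·-resp-≈ relator-trivial v≈w _)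
    ; inverse   =
        (λ {w} i≡ → ≈-trans (≈-reflexive (cong word (trans (cong P.to i≡) (P.strictlyInverseˡ (normalForm w)))))
                           (word-normalForm w))
      , (λ {i} w≈ → trans (cong P.from (trans (·-resp-≈ relator-trivial w≈ _) (normalForm-word (P.to i))))
                          (P.strictlyInverseʳ i))
    }
    where
    module P = Inverse (*↔× {2} {n})
    ≈-reflexive = Setoid.reflexive Dₙ

-- The graphs Xₙ

-- The transposition with index l maps 0 to l, so that the index of a generator
-- of X n can be read off the action of its first component: the indices 0, 1, 2
-- stand for c, a, b.
transposition : Fin 3 → Permutation′ 3
transposition 0F = transpose 1F 2F
transposition 1F = transpose 0F 1F
transposition 2F = transpose 0F 2F

rotation : Permutation′ 3
rotation = transpose 0F 2F ∘ₚ transpose 1F 2F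

transposition-0 : ∀ l → transposition l ⟨$⟩ʳ 0F ≡ l
transposition-0 = from-yes (all? λ l → transposition l ⟨$⟩ʳ 0F ≟ l)

transposition-involutive : ∀ l i → transposition l ⟨$⟩ʳ (transposition l ⟨$⟩ʳ i) ≡ i
transposition-involutive = from-yes (all? λ l → all? λ i →
  transposition l ⟨$⟩ʳ (transposition l ⟨$⟩ʳ i) ≟ i)

transposition-moves : ∀ l → ∃[ i ] transposition l ⟨$⟩ʳ i ≢ i
transposition-moves 0F = 1F , λ ()
transposition-moves 1F = 0F , λ ()
transposition-moves 2F = 0F , λ ()

⟨$⟩ʳ-injective : ∀ {n} (π : Permutation′ n) {i j} → π ⟨$⟩ʳ i ≡ π ⟨$⟩ʳ j → i ≡ j
⟨$⟩ʳ-injective π eq = trans (sym (inverseˡ π)) (trans (cong (π ⟨$⟩ˡ_) eq) (inverseˡ π))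

-- A permutation of three points is determined by its values at 0 and 1, from which `index` is
-- computed.
S₃-cardinality : HasCardinality (Group.setoid (symmetricGroup 3)) 6
S₃-cardinality = record
  { to        = element
  ; from      = λ π → index (π ⟨$⟩ʳ 0F) (π ⟨$⟩ʳ 1F)
  ; to-cong   = λ { refl _ → refl }
  ; from-cong = λ p → cong₂ index (p 0F) (p 1F)
  ; inverse   = (λ { {π} refl → element-index π })
              , (λ {i} p → trans (cong₂ index (p 0F) (p 1F)) (index-element i))
  }
  where
  element : Fin 6 → Permutation′ 3
  element 0F = idₚ
  element 1F = rotation
  element 2F = rotation ∘ₚ rotation
  element 3F = transposition 0F
  element 4F = transposition 1F
  element 5F = transposition 2F

  index : Fin 3 → Fin 3 → Fin 6
  index 0F 1F = 0F
  index 1F 2F = 1F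
  index 2F 0F = 2F
  index 0F 2F = 3F
  index 1F 0F = 4F
  index 2F 1F = 5F
  -- Default for equal arguments, which are never two values of a permutation.
  index _  _  = 0F

  index-element : ∀ i → index (element i ⟨$⟩ʳ 0F) (element i ⟨$⟩ʳ 1F) ≡ i
  index-element = from-yes (all? λ i → index (element i ⟨$⟩ʳ 0F) (element i ⟨$⟩ʳ 1F) ≟ i)

  values : ∀ i j k → i ≢ j → i ≢ k → j ≢ k → let π = element (index i j) in
           π ⟨$⟩ʳ 0F ≡ i × π ⟨$⟩ʳ 1F ≡ j × π ⟨$⟩ʳ 2F ≡ k
  values = from-yes (all? λ i → all? λ j → all? λ k →
    ¬? (i ≟ j) →-dec ¬? (i ≟ k) →-dec ¬? (j ≟ k) →-dec let π = element (index i j) in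
    (π ⟨$⟩ʳ 0F ≟ i) ×-dec (π ⟨$⟩ʳ 1F ≟ j) ×-dec (π ⟨$⟩ʳ 2F ≟ k))

  element-index : ∀ π i → element (index (π ⟨$⟩ʳ 0F) (π ⟨$⟩ʳ 1F)) ⟨$⟩ʳ i ≡ π ⟨$⟩ʳ i
  element-index π i with values (π ⟨$⟩ʳ 0F) (π ⟨$⟩ʳ 1F) (π ⟨$⟩ʳ 2F)
    ((λ ()) ∘ ⟨$⟩ʳ-injective π) ((λ ()) ∘ ⟨$⟩ʳ-injective π) ((λ ()) ∘ ⟨$⟩ʳ-injective π)
  element-index π 0F | eq , _  , _  = eq
  element-index π 1F | _  , eq , _  = eq
  element-index π 2F | _  , _  , eq = eq

-- D (3 * m) acts on ℤ₃ by r : i ↦ i + 1 and z : i ↦ - i.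
triangle : DihedralGen → Permutation′ 3
triangle r = rotation
triangle z = transposition 0F

open Act triangle using () renaming (_·_ to infixr 7 _▹_)

dihedralPart : Fin 3 → Presentation.Word DihedralGen
dihedralPart 0F = zrᴰ
dihedralPart 1F = Presentation.ε
dihedralPart 2F = zᴰ

S₃×D : ℕ → Group _ _
S₃×D n = symmetricGroup 3 ×ᴳ D n

generator : Fin 3 → Permutation′ 3 × Presentation.Word DihedralGen
generator l = transposition l , dihedralPart l

module CayleyX {n : ℕ} where
  private
    module G = Group (S₃×D n)
    module D = Group (D n)
    module X = Graph (X n)
  open G using (_≈_; _∙_; Carrier)
  open import Relation.Binary.Reasoning.Setoid G.setoid

  dihedralPart-involutive : ∀ l → dihedralPart l D.∙ dihedralPart l D.≈ D.ε
  dihedralPart-involutive 0F = D.trans (D.∙-congˡ (D.sym (D.identityʳ _))) (Presentation.relator zr²)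
  dihedralPart-involutive 1F = D.identityˡ _
  dihedralPart-involutive 2F = D.trans (D.∙-congˡ (D.sym (D.identityʳ _))) (Presentation.relator z²)

  generator-involutive : ∀ g l → (g ∙ generator l) ∙ generator l ≈ g
  generator-involutive g l = begin
    (g ∙ generator l) ∙ generator l  ≈⟨ G.assoc g (generator l) (generator l) ⟩
    g ∙ (generator l ∙ generator l)  ≈⟨ G.∙-congˡ {g} {generator l ∙ generator l} {G.ε} (transposition-involutive l , dihedralPart-involutive l) ⟩
    g ∙ G.ε                          ≈⟨ G.identityʳ g ⟩
    g                                ∎

  -- The image of 0 under the permutation part of `g⁻¹h`; for adjacent vertices it is the index of
  -- the generator `g⁻¹h`. It is total, so colours can be compared without carrying adjacency
  -- proofs.
  colour : Carrier → Carrier → Fin 3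
  colour g h = proj₁ g ⟨$⟩ˡ (proj₁ h ⟨$⟩ʳ 0F)

  colour-cong : ∀ {g g′ h h′} → g ≈ g′ → h ≈ h′ → colour g h ≡ colour g′ h′
  colour-cong {g} {g′} {h} {h′} (p , _) (q , _) = ⟨$⟩ʳ-injective (proj₁ g)
    (trans (inverseʳ (proj₁ g)) (trans (q 0F) (trans (sym (inverseʳ (proj₁ g′))) (sym (p _)))))

  colour-unique : ∀ {g h} l → h ≈ g ∙ generator l → colour g h ≡ l
  colour-unique {g} {h} l (eq , _) =
    trans (cong (proj₁ g ⟨$⟩ˡ_) (eq 0F)) (trans (inverseˡ (proj₁ g)) (transposition-0 l))

  -- The generators are involutions: an edge from `x` to `xs` is also multiplication by `s` when
  -- read from `xs`, so its colour does not depend on the direction.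
  ~⇒generator : ∀ {g h} → g X.~ h → ∃[ l ] h ≈ g ∙ generator l
  ~⇒generator {g} {h} (_ , (x , s , s∈S) , joins) = orient (index s∈S) joins
    where
    S : List Carrier
    S = generator 1F ∷ generator 2F ∷ generator 0F ∷ []

    index : s ∈ S → ∃[ l ] s ≡ generator l
    index (here refl)                 = 1F , refl
    index (there (here refl))         = 2F , refl
    index (there (there (here refl))) = 0F , refl

    orient : ∃[ l ] s ≡ generator l → (g ≈ x × h ≈ x ∙ s) ⊎ (g ≈ x ∙ s × h ≈ x) → ∃[ l ] h ≈ g ∙ generator l
    orient (l , refl) (inj₁ (g≈x , h≈xs)) = l , (begin
      h                ≈⟨ h≈xs ⟩
      x ∙ generator l  ≈⟨ G.∙-congʳ {generator l} {g} {x} g≈x ⟨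
      g ∙ generator l  ∎)
    orient (l , refl) (inj₂ (g≈xs , h≈x)) = l , (begin
      h                                ≈⟨ h≈x ⟩
      x                                ≈⟨ generator-involutive x l ⟨
      (x ∙ generator l) ∙ generator l  ≈⟨ G.∙-congʳ {generator l} {g} {x ∙ generator l} g≈xs ⟨
      g ∙ generator l                  ∎)

  ~⇒colour : ∀ {g h} → g X.~ h → h ≈ g ∙ generator (colour g h)
  ~⇒colour {g} {h} g~h with ~⇒generator {g} {h} g~h
  ... | l , eq = subst (λ k → h ≈ g ∙ generator k) (sym (colour-unique {g} {h} l eq)) eq

  generator⇒~ : ∀ g l → g X.~ g ∙ generator l
  generator⇒~ g l = distinct , (g , generator l , member l) , inj₁ (G.refl {g} , G.refl {g ∙ generator l})
    where
    member : ∀ l → generator l ∈ (generator 1F ∷ generator 2F ∷ generator 0F ∷ [])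
    member 0F = there (there (here refl))
    member 1F = here refl
    member 2F = there (here refl)

    distinct : ¬ g ≈ g ∙ generator l
    distinct (eq , _) with transposition-moves l
    ... | i , moves = moves (⟨$⟩ʳ-injective (proj₁ g) (sym (eq i)))

  -- Left translations are automorphisms.
  X-vertexTransitive : VertexTransitive (X n)
  X-vertexTransitive g h = record
    { bijection = record
        { to        = t ∙_
        ; from      = (t G.⁻¹) ∙_
        ; to-cong   = λ {x} {y} → G.∙-congˡ {t} {x} {y}
        ; from-cong = λ {x} {y} → G.∙-congˡ {t G.⁻¹} {x} {y}
        ; inverse   =
            (λ {x} {y} eq → G.trans {t ∙ y} {t ∙ (t G.⁻¹ ∙ x)} {x} (G.∙-congˡ {t} {y} {t G.⁻¹ ∙ x} eq) (cancel t (t G.⁻¹) x (G.inverseʳ t)))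
          , (λ {x} {y} eq → G.trans {t G.⁻¹ ∙ y} {t G.⁻¹ ∙ (t ∙ x)} {x} (G.∙-congˡ {t G.⁻¹} {y} {t ∙ x} eq) (cancel (t G.⁻¹) t x (G.inverseˡ t)))
        }
    ; adjacency = λ x y → mk⇔ (translate t x y) (λ adj →
        X.~-resp {t G.⁻¹ ∙ (t ∙ x)} {x} {t G.⁻¹ ∙ (t ∙ y)} {y}
          (cancel (t G.⁻¹) t x (G.inverseˡ t)) (cancel (t G.⁻¹) t y (G.inverseˡ t))
          (translate (t G.⁻¹) (t ∙ x) (t ∙ y) adj))
    } , (begin
      t ∙ g               ≈⟨ G.assoc h (g G.⁻¹) g ⟩
      h ∙ (g G.⁻¹ ∙ g)    ≈⟨ G.∙-congˡ {h} {g G.⁻¹ ∙ g} {G.ε} (G.inverseˡ g) ⟩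
      h ∙ G.ε             ≈⟨ G.identityʳ h ⟩
      h                   ∎)
    where
    t : Carrier
    t = h ∙ g G.⁻¹

    cancel : ∀ s s′ x → s ∙ s′ ≈ G.ε → s ∙ (s′ ∙ x) ≈ x
    cancel s s′ x eq = begin
      s ∙ (s′ ∙ x)  ≈⟨ G.assoc s s′ x ⟨
      (s ∙ s′) ∙ x  ≈⟨ G.∙-congʳ {x} {s ∙ s′} {G.ε} eq ⟩
      G.ε ∙ x       ≈⟨ G.identityˡ x ⟩
      x             ∎

    translate : ∀ s x y → x X.~ y → (s ∙ x) X.~ (s ∙ y)
    translate s x y x~y with ~⇒generator {x} {y} x~y
    ... | l , y≈xl = X.~-resp {s ∙ x} {s ∙ x} {(s ∙ x) ∙ generator l} {s ∙ y} (G.refl {s ∙ x}) (begin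
      (s ∙ x) ∙ generator l  ≈⟨ G.assoc s x (generator l) ⟩
      s ∙ (x ∙ generator l)  ≈⟨ G.∙-congˡ {s} {y} {x ∙ generator l} y≈xl ⟨
      s ∙ y                  ∎) (generator⇒~ (s ∙ x) l)

  X-cubic : IsCubic (X n)
  X-cubic g = record
    { to        = λ l → g ∙ generator l , generator⇒~ g l
    ; from      = λ (h , _) → colour g h
    ; to-cong   = λ { {l} refl → G.refl {g ∙ generator l} }
    ; from-cong = λ { {h , _} {h′ , _} h≈h′ → colour-cong {g} {g} {h} {h′} (G.refl {g}) h≈h′ }
    ; inverse   = (λ { {h , g~h} refl → G.sym {h} {g ∙ generator (colour g h)} (~⇒colour {g} {h} g~h) })
                , (λ { {l} {h , _} eq → colour-unique {g} {h} l eq })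
    }

-- Order and rainbow domination

X-order : ∀ m → 1 ≤ m → HasOrder (X (3 * m)) (36 * m)
X-order (suc p) _ = subst (HasOrder (X (3 * suc p))) (order (suc p)) (×-cardinality S₃-cardinality (Dihedral.cardinality _))
  where
  order : ∀ m → 6 * (2 * (3 * m)) ≡ 36 * m
  order = solve-∀

cardinality-unique : ∀ {A j k} → HasCardinality A j → HasCardinality A k → j ≡ k
cardinality-unique I J = ↔⇒≡ (mk↔ₛ′ (J.from ∘ I.to) (I.from ∘ J.to)
  (λ i → trans (J.from-cong (I.strictlyInverseˡ _)) (J.strictlyInverseʳ i))
  (λ i → trans (I.from-cong (J.strictlyInverseˡ _)) (I.strictlyInverseʳ i)))
  where
  module I = Inverse I
  module J = Inverse J

module _ (m : ℕ) where
  open Presentation DihedralGen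

  -- The rotation of three points has order 3, so `r` to the power `3m` acts trivially. This is
  -- where divisibility of `n` by 3 enters.
  relator-fixes : ∀ {w} → DihedralRelator (3 * m) w → ∀ i → w ▹ i ≡ i
  relator-fixes rⁿ  i = subst (λ k → rᴰ ^ k ▹ i ≡ i) (*-comm m 3) (rotate m i)
    where
    rotate : ∀ m i → rᴰ ^ (m * 3) ▹ i ≡ i
    rotate zero    i = refl
    rotate (suc m) i = trans (from-yes (all? λ j → rᴰ ▹ rᴰ ▹ rᴰ ▹ j ≟ j) _) (rotate m i)
  relator-fixes z²  i = from-yes (all? λ i → zᴰ ▹ zᴰ ▹ i ≟ i) i
  relator-fixes zr² i = from-yes (all? λ i → zrᴰ ▹ zrᴰ ▹ i ≟ i) i

  triangle-resp-≈ : ∀ {w w′} → Group._≈_ (D (3 * m)) w w′ → ∀ i → w ▹ i ≡ w′ ▹ i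
  triangle-resp-≈ = Act.·-resp-≈ triangle relator-fixes

∣p∪q∣≤∣p∣+∣q∣ : ∀ {n} (p q : Subset n) → ∣ p ∪ q ∣ ≤ ∣ p ∣ + ∣ q ∣
∣p∪q∣≤∣p∣+∣q∣ []          []          = z≤n
∣p∪q∣≤∣p∣+∣q∣ (true  ∷ p) (true  ∷ q) = s≤s (≤-trans (∣p∪q∣≤∣p∣+∣q∣ p q) (+-monoʳ-≤ ∣ p ∣ (n≤1+n ∣ q ∣)))
∣p∪q∣≤∣p∣+∣q∣ (true  ∷ p) (false ∷ q) = s≤s (∣p∪q∣≤∣p∣+∣q∣ p q)
∣p∪q∣≤∣p∣+∣q∣ (false ∷ p) (true  ∷ q) = ≤-trans (s≤s (∣p∪q∣≤∣p∣+∣q∣ p q)) (≤-reflexive (sym (+-suc ∣ p ∣ ∣ q ∣)))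
∣p∪q∣≤∣p∣+∣q∣ (false ∷ p) (false ∷ q) = ∣p∪q∣≤∣p∣+∣q∣ p q

∣p∣≡0⇒p≡⊥ : ∀ {n} (p : Subset n) → ∣ p ∣ ≡ 0 → p ≡ ⊥
∣p∣≡0⇒p≡⊥ []          _  = refl
∣p∣≡0⇒p≡⊥ (false ∷ p) eq = cong (false ∷_) (∣p∣≡0⇒p≡⊥ p eq)

sum-mono-≤ : ∀ {n} {f g : Fin n → ℕ} → (∀ i → f i ≤ g i) → sum f ≤ sum g
sum-mono-≤ {zero}  _   = z≤n
sum-mono-≤ {suc _} f≤g = +-mono-≤ (f≤g zero) (sum-mono-≤ (f≤g ∘ suc))

sum-const : ∀ n k → sum {n} (λ _ → k) ≡ n * k
sum-const zero    k = refl
sum-const (suc n) k = cong (k +_) (sum-const n k)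

module Domination (m k : ℕ) (enum : HasOrder (X (3 * m)) k) where
  private
    n = 3 * m
    module G = Group (S₃×D n)
    module D = Group (D n)
    module X = Graph (X n)
    module E = Inverse enum
  open G using (Carrier; _≈_; _∙_)
  open CayleyX {n}

  -- Right multiplication by a generator is an involution of the vertex set, so it merely reorders
  -- the sum.
  sum-translate : (F : Carrier → ℕ) → (∀ {g h} → g ≈ h → F g ≡ F h) → ∀ l →
                  sum (λ i → F (E.to i ∙ generator l)) ≡ sum (λ i → F (E.to i))
  sum-translate F F-cong l = sym (trans (sum-permute (F ∘ E.to) π) (sum-cong-≗ λ i →
    F-cong {E.to (π ⟨$⟩ʳ i)} {E.to i ∙ generator l} (E.strictlyInverseˡ _)))
    where
    involutive : ∀ i → E.from (E.to (E.from (E.to i ∙ generator l)) ∙ generator l) ≡ i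
    involutive i = trans (E.from-cong {E.to (E.from (E.to i ∙ generator l)) ∙ generator l} {E.to i}
      (G.trans {E.to (E.from (E.to i ∙ generator l)) ∙ generator l} {(E.to i ∙ generator l) ∙ generator l} {E.to i}
        (G.∙-congʳ {generator l} {E.to (E.from (E.to i ∙ generator l))} {E.to i ∙ generator l} (E.strictlyInverseˡ _))
        (generator-involutive (E.to i) l)))
      (E.strictlyInverseʳ i)

    π : Permutation′ k
    π = mk↔ₛ′ (λ i → E.from (E.to i ∙ generator l)) (λ i → E.from (E.to i ∙ generator l)) involutive involutive

  module _ (f : Labelling (X n)) where
    private
      F : Carrier → ℕ
      F g = ∣ Func.to f g ∣

      F-cong : ∀ {g h} → g ≈ h → F g ≡ F h
      F-cong {g} {h} eq = cong ∣_∣ (Func.cong f {g} {h} eq)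

    charge : Carrier → ℕ
    charge g = 3 * F g + (F (g ∙ generator 0F) + (F (g ∙ generator 1F) + F (g ∙ generator 2F)))

    -- Each vertex counts three times in its own charge and once in that of each of its three
    -- neighbours.
    sum-charge : sum (charge ∘ E.to) ≡ 6 * weight (X n) enum f
    sum-charge = begin
      sum (charge ∘ E.to)
        ≡⟨ ∑-distrib-+ (λ i → 3 * F (E.to i)) _ ⟩
      sum (λ i → 3 * F (E.to i)) + sum (λ i → T 0F i + (T 1F i + T 2F i))
        -- The product `3 * F` unfolds to `F + (F + (F + 0))`; the final zero is the source of the
        -- summand `k * 0`.
        ≡⟨ cong₂ _+_ (trans (∑-distrib-+ (F ∘ E.to) _) (cong (W +_) (trans (∑-distrib-+ (F ∘ E.to) _)
             (cong (W +_) (trans (∑-distrib-+ (F ∘ E.to) _) (cong (W +_) (sum-const k 0)))))))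
             (trans (∑-distrib-+ (T 0F) _) (cong₂ _+_ (translate 0F)
               (trans (∑-distrib-+ (T 1F) _) (cong₂ _+_ (translate 1F) (translate 2F))))) ⟩
      (W + (W + (W + k * 0))) + (W + (W + W))
        ≡⟨ arithmetic W k ⟩
      6 * W ∎
      where
      open ≡-Reasoning
      W = sum (F ∘ E.to)
      T : Fin 3 → Fin k → ℕ
      T l i = F (E.to i ∙ generator l)
      translate : ∀ l → sum (T l) ≡ W
      translate = sum-translate F (λ {g} {h} → F-cong {g} {h})
      arithmetic : ∀ W k → (W + (W + (W + k * 0))) + (W + (W + W)) ≡ 6 * W
      arithmetic = solve-∀

    -- A non-empty label contributes 3 by itself. Around an empty label the three neighbouring
    -- labels have union `⊤`, so their sizes add up to at least 3.
    3≤charge : Is3RDF (X n) f → ∀ g → 3 ≤ charge g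
    3≤charge dominating g with F g in eq
    ... | suc j = ≤-trans (*-monoʳ-≤ 3 (s≤s {0} {j} z≤n)) (m≤m+n _ _)
    ... | zero  = begin
      3                  ≡⟨ ∣⊤∣≡n 3 ⟨
      ∣ ⊤ {3} ∣          ≤⟨ p⊆q⇒∣p∣≤∣q∣ {p = ⊤} {q = P ∪ (Q ∪ R)} (λ {c} _ → covered c) ⟩
      ∣ P ∪ (Q ∪ R) ∣    ≤⟨ ≤-trans (∣p∪q∣≤∣p∣+∣q∣ P (Q ∪ R)) (+-monoʳ-≤ ∣ P ∣ (∣p∪q∣≤∣p∣+∣q∣ Q R)) ⟩
      ∣ P ∣ + (∣ Q ∣ + ∣ R ∣)  ∎
      where
      open ≤-Reasoning
      N : Fin 3 → Subset 3
      N l = Func.to f (g ∙ generator l)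
      P = N 0F
      Q = N 1F
      R = N 2F

      place : ∀ {c} l → c ∈ˢ N l → c ∈ˢ P ∪ (Q ∪ R)
      place 0F c∈ = x∈p∪q⁺ (inj₁ c∈)
      place 1F c∈ = x∈p∪q⁺ (inj₂ (x∈p∪q⁺ (inj₁ c∈)))
      place 2F c∈ = x∈p∪q⁺ (inj₂ (x∈p∪q⁺ (inj₂ c∈)))

      covered : ∀ c → c ∈ˢ P ∪ (Q ∪ R)
      covered c with dominating g (∣p∣≡0⇒p≡⊥ _ eq) c
      ... | h , g~h , c∈ = place (colour g h)
        (subst (c ∈ˢ_) (Func.cong f {h} {g ∙ generator (colour g h)} (~⇒colour {g} {h} g~h)) c∈)

  weight-lower-bound : ∀ f → Is3RDF (X n) f → k * 3 ≤ 6 * weight (X n) enum f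
  weight-lower-bound f dominating = begin
    k * 3                       ≡⟨ sum-const k 3 ⟨
    sum {k} (λ _ → 3)           ≤⟨ sum-mono-≤ (3≤charge f dominating ∘ E.to) ⟩
    sum (charge f ∘ E.to)       ≡⟨ sum-charge f ⟩
    6 * weight (X n) enum f     ∎
    where open ≤-Reasoning

  isEven : Fin 3 → Fin 3 → Bool
  isEven i j = does (rotation ⟨$⟩ʳ i ≟ j)

  -- A permutation of three points is even iff it is a power of the rotation.
  even : Permutation′ 3 → Bool
  even σ = isEven (σ ⟨$⟩ʳ 0F) (σ ⟨$⟩ʳ 1F)

  even-transposition : ∀ σ l → even (transposition l ∘ₚ σ) ≡ not (even σ)
  even-transposition σ = λ { 0F → proj₁ parities ; 1F → proj₁ (proj₂ parities) ; 2F → proj₂ (proj₂ parities) }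
    where
    -- If `i`, `j`, `k` are the values of `σ` at 0, 1, 2, the conjuncts treat the values at 0 and 1
    -- after precomposing with each of the three transpositions.
    swaps : ∀ i j k → i ≢ j → i ≢ k → j ≢ k →
            isEven i k ≡ not (isEven i j) × isEven j i ≡ not (isEven i j) × isEven k j ≡ not (isEven i j)
    swaps = from-yes (all? λ i → all? λ j → all? λ k → ¬? (i ≟ j) →-dec ¬? (i ≟ k) →-dec ¬? (j ≟ k) →-dec
      (isEven i k Bool.≟ not (isEven i j)) ×-dec (isEven j i Bool.≟ not (isEven i j)) ×-dec (isEven k j Bool.≟ not (isEven i j)))
    parities = swaps (σ ⟨$⟩ʳ 0F) (σ ⟨$⟩ʳ 1F) (σ ⟨$⟩ʳ 2F)
      ((λ ()) ∘ ⟨$⟩ʳ-injective σ) ((λ ()) ∘ ⟨$⟩ʳ-injective σ) ((λ ()) ∘ ⟨$⟩ʳ-injective σ)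

  label : Bool → Fin 3 → Subset 3
  label false _ = ⊥
  label true  c = ⁅ c ⁆

  rainbow : Labelling (X n)
  rainbow = record
    { to   = λ (σ , w) → label (even σ) (w ▹ 2F)
    ; cong = λ { {_ , w} {_ , w′} (p , q) → cong₂ label (cong₂ isEven (p 0F) (p 1F)) (triangle-resp-≈ m {w} {w′} q 2F) }
    }

  rainbow-dominating : Is3RDF (X n) rainbow
  rainbow-dominating g@(σ , w) f≡⊥ c = g ∙ generator l , generator⇒~ g l ,
    subst (c ∈ˢ_) (cong₂ label (sym odd-neighbour) (sym colour-c)) (x∈⁅x⁆ c)
    where
    open Act triangle using (action)
    -- The colour `c` pulled back through `w`: the required neighbour is the one whose dihedral part
    -- sends 2 to this point.
    point : Fin 3
    point = Inverse.from (action w) c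

    towards : ∀ i → ∃[ l ] dihedralPart l ▹ 2F ≡ i
    towards 0F = 0F , refl
    towards 1F = 2F , refl
    towards 2F = 1F , refl

    l : Fin 3
    l = proj₁ (towards point)

    colour-c : w ▹ dihedralPart l ▹ 2F ≡ c
    colour-c = trans (cong (w ▹_) (proj₂ (towards point))) (Inverse.strictlyInverseˡ (action w) c)

    odd : ∀ b → label b (w ▹ 2F) ≡ ⊥ → b ≡ false
    odd false _  = refl
    odd true  eq = contradiction (subst ((w ▹ 2F) ∈ˢ_) eq (x∈⁅x⁆ _)) ∉⊥

    odd-neighbour : even (transposition l ∘ₚ σ) ≡ true
    odd-neighbour = trans (even-transposition σ l) (cong not (odd (even σ) f≡⊥))

  -- The lower bound is sharp at every vertex: non-empty labels are singletons with three empty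
  -- neighbours, and empty labels have three singleton neighbours. The weight follows without
  -- counting even permutations.
  charge-rainbow : ∀ g → charge rainbow g ≡ 3
  charge-rainbow (σ , w)
    rewrite even-transposition σ 0F | even-transposition σ 1F | even-transposition σ 2F =
    total (even σ) _ _ _ _
    where
    total : ∀ b i i₀ i₁ i₂ →
      3 * ∣ label b i ∣ + (∣ label (not b) i₀ ∣ + (∣ label (not b) i₁ ∣ + ∣ label (not b) i₂ ∣)) ≡ 3
    total true  i _  _  _  = cong (λ t → 3 * t + 0) (∣⁅x⁆∣≡1 i)
    total false _ i₀ i₁ i₂ = cong₂ _+_ (∣⁅x⁆∣≡1 i₀) (cong₂ _+_ (∣⁅x⁆∣≡1 i₁) (∣⁅x⁆∣≡1 i₂))

  weight-rainbow : 6 * weight (X n) enum rainbow ≡ k * 3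
  weight-rainbow = trans (sym (sum-charge rainbow)) (trans (sum-cong-≗ (charge-rainbow ∘ E.to)) (sum-const k 3))

X-3RDR : ∀ m → 1 ≤ m → Is3RDR (X (3 * m))
X-3RDR m 1≤m = CayleyX.X-cubic , 36 * m , enum , 18 * m ,
  ( (rainbow , rainbow-dominating , *-cancelˡ-≡ _ _ 6 (trans weight-rainbow (six m)))
  , λ f dominating → *-cancelˡ-≤ 6 (subst (_≤ 6 * weight (X (3 * m)) enum f) (six m) (weight-lower-bound f dominating)))
  , two m
  where
  enum = X-order m 1≤m
  open Domination m (36 * m) enum
  six : ∀ m → 36 * m * 3 ≡ 6 * (18 * m)
  six = solve-∀
  two : ∀ m → 2 * (18 * m) ≡ 36 * m
  two = solve-∀

-- Colour words of closed walks

ColourWord : ℕ → Set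
ColourWord = Vec (Fin 3)

along₁ along₂ : ∀ {k} → ColourWord k → Fin 3 → Fin 3
along₁ w i = foldr′ (λ l j → transposition l ⟨$⟩ʳ j) i w
along₂ w i = foldr′ (λ l j → dihedralPart l ▹ j) i w

Reduced : ∀ {k} → ColourWord k → Set
Reduced = Linked _≢_

-- Since D₃ acts faithfully on three points, this is triviality of `w` in S₃ × D₃. It is decidable
-- uniformly in `m`, and every closed walk in `X (3 * m)` satisfies it.
record Closed {k} (w : ColourWord k) : Set where
  constructor closes
  field
    fixes₁ : ∀ i → along₁ w i ≡ i
    fixes₂ : ∀ i → along₂ w i ≡ i

closed? : ∀ {k} (w : ColourWord k) → Dec (Closed w)
closed? w = map′ (λ (p , q) → closes p q) (λ (closes p q) → p , q)
  (all? (λ i → along₁ w i ≟ i) ×-dec all? (λ i → along₂ w i ≟ i))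

-- Words are extended letter by letter and dropped at the first repetition, which leaves
-- `3 * 2^(k-1)` words of length `k ≥ 1` to test.
allReduced? : ∀ {k} {P : ColourWord k → Set} → (∀ w → Dec (P w)) → Dec (∀ w → Reduced w → P w)
allReduced? {zero}  P? = map′ (λ { p [] _ → p }) (λ f → f [] []) (P? [])
allReduced? {suc k} P? = map′ (λ { f (c ∷ w) → f c w }) (λ f c w → f (c ∷ w))
  (all? λ c → after? c (P? ∘ (c ∷_)))
  where
  after? : ∀ c {k} {P : ColourWord k → Set} → (∀ w → Dec (P w)) → Dec (∀ w → Reduced (c ∷ w) → P w)
  after? c {zero}  P? = map′ (λ { p [] _ → p }) (λ f → f [] [-]) (P? [])
  after? c {suc k} P? = map′
    (λ { f (d ∷ w) (c≢d ∷ red) → f d c≢d w red })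
    (λ f d c≢d w red → f (d ∷ w) (c≢d ∷ red))
    (all? λ d → ¬? (c ≟ d) →-dec after? d (P? ∘ (d ∷_)))

abstract
  hexagon-colours : (w : ColourWord 6) → Reduced w → Closed w → All (_≢ 1F) w
  hexagon-colours = from-yes (allReduced? {6} λ w → closed? w →-dec All.all? (λ c → ¬? (c ≟ 1F)) w)

-- The word o₀ s₁ τ₁ s₃ o₁ s₂ τ₀ s₀ lists the colours along the 8-cycle
--
--      ┌── o₁ ──┐
--      s₂       s₃
--      τ₀       τ₁
--      s₀       s₁
--      └── o₀ ──┘
--
-- of a generalized Petersen graph, where s, o and τ are the colours of spokes,
-- outer and inner edges.  The octagon w′ lies to the right of w if w ◁ w′, and
-- above w if w △ w′.
IsOctagon : ColourWord 8 → Set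
IsOctagon w = lookup w 0F ≢ lookup w 7F × Closed w

isOctagon? : ∀ w → Dec (IsOctagon w)
isOctagon? w = ¬? (lookup w 0F ≟ lookup w 7F) ×-dec closed? w

infix 4 _◁_ _△_

_◁_ _△_ : ColourWord 8 → ColourWord 8 → Set
(o₀ ∷ s₁ ∷ τ₁ ∷ s₃ ∷ o₁ ∷ s₂ ∷ τ₀ ∷ s₀ ∷ []) ◁ (o₀′ ∷ s₁′ ∷ τ₁′ ∷ s₃′ ∷ o₁′ ∷ s₂′ ∷ τ₀′ ∷ s₀′ ∷ []) =
  o₀ ≢ o₀′ × o₁ ≢ o₁′ × s₁ ≡ s₀′ × τ₁ ≡ τ₀′ × s₃ ≡ s₂′
(o₀ ∷ s₁ ∷ τ₁ ∷ s₃ ∷ o₁ ∷ s₂ ∷ τ₀ ∷ s₀ ∷ []) △ (o₀′ ∷ s₁′ ∷ τ₁′ ∷ s₃′ ∷ o₁′ ∷ s₂′ ∷ τ₀′ ∷ s₀′ ∷ []) =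
  τ₀ ≢ τ₀′ × τ₁ ≢ τ₁′ × s₂ ≡ s₀′ × o₁ ≡ o₀′ × s₃ ≡ s₁′

_◁?_ : ∀ w w′ → Dec (w ◁ w′)
(o₀ ∷ s₁ ∷ τ₁ ∷ s₃ ∷ o₁ ∷ s₂ ∷ τ₀ ∷ s₀ ∷ []) ◁? (o₀′ ∷ s₁′ ∷ τ₁′ ∷ s₃′ ∷ o₁′ ∷ s₂′ ∷ τ₀′ ∷ s₀′ ∷ []) =
  ¬? (o₀ ≟ o₀′) ×-dec ¬? (o₁ ≟ o₁′) ×-dec (s₁ ≟ s₀′) ×-dec (τ₁ ≟ τ₀′) ×-dec (s₃ ≟ s₂′)

_△?_ : ∀ w w′ → Dec (w △ w′)
(o₀ ∷ s₁ ∷ τ₁ ∷ s₃ ∷ o₁ ∷ s₂ ∷ τ₀ ∷ s₀ ∷ []) △? (o₀′ ∷ s₁′ ∷ τ₁′ ∷ s₃′ ∷ o₁′ ∷ s₂′ ∷ τ₀′ ∷ s₀′ ∷ []) =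
  ¬? (τ₀ ≟ τ₀′) ×-dec ¬? (τ₁ ≟ τ₁′) ×-dec (s₂ ≟ s₀′) ×-dec (o₁ ≟ o₀′) ×-dec (s₃ ≟ s₁′)

abstract
  -- A search over a 2 by 2 block of octagons: `w′` to the right of `w`, with `x` and `x′` above
  -- them. Conditions on one word precede the next word so that failures prune the search. Position
  -- 7 holds the spoke `s₀`.
  block-spoke : (w : ColourWord 8) → Reduced w → IsOctagon w →
                (w′ : ColourWord 8) → Reduced w′ → w ◁ w′ → IsOctagon w′ →
                (x : ColourWord 8) → Reduced x → w △ x → IsOctagon x →
                (x′ : ColourWord 8) → Reduced x′ → w′ △ x′ → IsOctagon x′ →
                lookup w 7F ≡ 1F
  block-spoke = from-yes (
    allReduced? {8} λ w → isOctagon? w →-dec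
    allReduced? {8} λ w′ → (w ◁? w′) →-dec isOctagon? w′ →-dec
    allReduced? {8} λ x → (w △? x) →-dec isOctagon? x →-dec
    allReduced? {8} λ x′ → (w′ △? x′) →-dec isOctagon? x′ →-dec
    (lookup w 7F ≟ 1F))

-- Graphs isomorphic to Xₙ

module Transport (m : ℕ) {H : Graph} (φ : X (3 * m) ≅ H) where
  private
    n = 3 * m
    module G = Group (S₃×D n)
    module D = Group (D n)
    module X = Graph (X n)
    module φ = Inverse (_≅_.bijection φ)
  open G using (Carrier; _≈_; _∙_)
  open CayleyX {n}
  open Graph H

  module ≈ᵛ = Setoid vertices

  position : V → Carrier
  position = φ.from

  position-injective : ∀ {x y} → position x ≈ position y → x ≈ᵛ y
  position-injective {x} {y} eq =
    ≈ᵛ.trans (≈ᵛ.sym (φ.strictlyInverseˡ x)) (≈ᵛ.trans (φ.to-cong {position x} {position y} eq) (φ.strictlyInverseˡ y))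

  hue : V → V → Fin 3
  hue x y = colour (position x) (position y)

  step : ∀ {x y} → x ~ y → position y ≈ position x ∙ generator (hue x y)
  step {x} {y} x~y = ~⇒colour {position x} {position y} (Equivalence.from (_≅_.adjacency φ (position x) (position y))
    (~-resp (≈ᵛ.sym (φ.strictlyInverseˡ x)) (≈ᵛ.sym (φ.strictlyInverseˡ y)) x~y))

  step-back : ∀ {x y} → x ~ y → position x ≈ position y ∙ generator (hue x y)
  step-back {x} {y} x~y = begin
    position x                                                ≈⟨ generator-involutive (position x) (hue x y) ⟨
    (position x ∙ generator (hue x y)) ∙ generator (hue x y)  ≈⟨ G.∙-congʳ {generator (hue x y)} {position y} {position x ∙ generator (hue x y)} (step x~y) ⟨
    position y ∙ generator (hue x y)                          ∎
    where open import Relation.Binary.Reasoning.Setoid G.setoid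

  hue-sym : ∀ {x y} → x ~ y → hue y x ≡ hue x y
  hue-sym {x} {y} x~y = colour-unique {position y} {position x} (hue x y) (step-back x~y)

  hue-injective : ∀ {x y y′} → x ~ y → x ~ y′ → hue x y ≡ hue x y′ → y ≈ᵛ y′
  hue-injective {x} {y} {y′} x~y x~y′ eq = position-injective (begin
    position y                         ≈⟨ step x~y ⟩
    position x ∙ generator (hue x y)   ≡⟨ cong (λ l → position x ∙ generator l) eq ⟩
    position x ∙ generator (hue x y′)  ≈⟨ step x~y′ ⟨
    position y′                        ∎)
    where open import Relation.Binary.Reasoning.Setoid G.setoid

  -- The colouring of edges by generators is proper, so a walk changes colour wherever it does not
  -- turn back. This makes colour words reduced.
  turn : ∀ {x y t} → x ~ y → y ~ t → ¬ x ≈ᵛ t → hue x y ≢ hue y t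
  turn x~y y~t x≉t eq = x≉t (hue-injective (~-sym x~y) y~t (trans (hue-sym x~y) eq))

  -- The three generators lead to neighbours with three different hues. This excludes the degenerate
  -- parameters for which the candidate graph is not cubic.
  no-degree-two : ∀ x p q → ¬ (∀ y → x ~ y → y ≈ᵛ p ⊎ y ≈ᵛ q)
  no-degree-two x p q two = two-colours (hue x p) (hue x q) λ l → covers l (two (neighbour l) (adjacent l))
    where
    two-colours : ∀ j k → ¬ (∀ (l : Fin 3) → l ≡ j ⊎ l ≡ k)
    two-colours = from-yes (all? {3} λ j → all? {3} λ k → ¬? (all? λ l → (l ≟ j) ⊎-dec (l ≟ k)))

    neighbour : Fin 3 → V
    neighbour l = φ.to (position x ∙ generator l)

    adjacent : ∀ l → x ~ neighbour l
    adjacent l = ~-resp (φ.strictlyInverseˡ x) ≈ᵛ.refl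
      (Equivalence.to (_≅_.adjacency φ (position x) (position x ∙ generator l)) (generator⇒~ (position x) l))

    hue-neighbour : ∀ l → hue x (neighbour l) ≡ l
    hue-neighbour l = colour-unique {position x} {position (neighbour l)} l (φ.strictlyInverseʳ _)

    hue-cong : ∀ {y y′} → y ≈ᵛ y′ → hue x y ≡ hue x y′
    hue-cong {y} {y′} eq = colour-cong {position x} {position x} {position y} {position y′} (G.refl {position x}) (φ.from-cong eq)

    covers : ∀ l → neighbour l ≈ᵛ p ⊎ neighbour l ≈ᵛ q → l ≡ hue x p ⊎ l ≡ hue x q
    covers l (inj₁ eq) = inj₁ (trans (sym (hue-neighbour l)) (hue-cong eq))
    covers l (inj₂ eq) = inj₂ (trans (sym (hue-neighbour l)) (hue-cong eq))

  infixr 5 _∷_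

  -- A step records a group equation instead of an adjacency, so an edge traversed backwards can
  -- keep the colour of its forward direction.
  data Walk : ∀ {k} → V → ColourWord k → V → Set where
    []  : ∀ {x} → Walk x [] x
    _∷_ : ∀ {k x y t c} {w : ColourWord k} → position y ≈ position x ∙ generator c → Walk y w t → Walk x (c ∷ w) t

  along-walk₁ : ∀ {k x y} {w : ColourWord k} → Walk x w y → ∀ i →
    proj₁ (position y) ⟨$⟩ʳ i ≡ proj₁ (position x) ⟨$⟩ʳ along₁ w i
  along-walk₁ []            i = refl
  along-walk₁ ((p , _) ∷ ω) i = trans (along-walk₁ ω i) (p _)

  along-walk₂ : ∀ {k x y} {w : ColourWord k} → Walk x w y → ∀ i →
    proj₂ (position y) ▹ i ≡ proj₂ (position x) ▹ along₂ w i
  along-walk₂ []                          i = refl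
  along-walk₂ {x = x} (_∷_ {y = y} {c = c} (_ , p) ω) i = trans (along-walk₂ ω i)
    (triangle-resp-≈ m {proj₂ (position y)} {proj₂ (position x) D.∙ dihedralPart c} p _)

  -- A walk multiplies the position on the right by its generators; on return to `x`, the position
  -- of `x` cancels on the left.
  closed : ∀ {k x} {w : ColourWord k} → Walk x w x → Closed w
  closed {x = x} ω = closes
    (λ i → ⟨$⟩ʳ-injective (proj₁ (position x)) (sym (along-walk₁ ω i)))
    (λ i → Act.·-injective triangle (proj₂ (position x)) (sym (along-walk₂ ω i)))

  hexagon : ∀ {x₀ x₁ x₂ x₃ x₄ x₅} → x₀ ~ x₁ → x₁ ~ x₂ → x₂ ~ x₃ → x₃ ~ x₄ → x₄ ~ x₅ → x₅ ~ x₀ →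
    ¬ x₀ ≈ᵛ x₂ → ¬ x₁ ≈ᵛ x₃ → ¬ x₂ ≈ᵛ x₄ → ¬ x₃ ≈ᵛ x₅ → ¬ x₄ ≈ᵛ x₀ →
    hue x₁ x₂ ≢ 1F × hue x₂ x₃ ≢ 1F
  hexagon {x₀} {x₁} {x₂} {x₃} {x₄} {x₅} e₀ e₁ e₂ e₃ e₄ e₅ n₀ n₁ n₂ n₃ n₄ = middle (hexagon-colours colours
      (turn e₀ e₁ n₀ ∷ turn e₁ e₂ n₁ ∷ turn e₂ e₃ n₂ ∷ turn e₃ e₄ n₃ ∷ turn e₄ e₅ n₄ ∷ [-])
      (closed {w = colours} (step e₀ ∷ step e₁ ∷ step e₂ ∷ step e₃ ∷ step e₄ ∷ step e₅ ∷ [])))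
    where
    colours : ColourWord 6
    colours = hue x₀ x₁ ∷ hue x₁ x₂ ∷ hue x₂ x₃ ∷ hue x₃ x₄ ∷ hue x₄ x₅ ∷ hue x₅ x₀ ∷ []

    middle : ∀ {a b c d e f} → All (_≢ 1F) (a ∷ b ∷ c ∷ d ∷ e ∷ f ∷ []) → b ≢ 1F × c ≢ 1F
    middle (_ ∷ b ∷ c ∷ _) = b , c

  -- The hexagons p₀p₁p₂q₂q₁q₀ and p₄p₃p₂q₂q₃q₄ cover all three edges at p₂, one
  -- of which has colour 1F.
  no-ladder : (p q : ℕ → V) → (∀ t → p t ~ p (suc t)) → (∀ t → q t ~ q (suc t)) →
    p 0 ~ q 0 → p 2 ~ q 2 → p 4 ~ q 4 →
    (∀ t → ¬ p t ≈ᵛ p (2 + t)) → (∀ t → ¬ q t ≈ᵛ q (2 + t)) →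
    (∀ t → ¬ p t ≈ᵛ q (suc t)) → (∀ t → ¬ q t ≈ᵛ p (suc t)) → Empty
  no-ladder p q pp qq e₀ e₂ e₄ p≉p q≉q p≉q q≉p =
    three-colours (hue (p 1) (p 2)) (hue (p 3) (p 2)) (hue (p 2) (q 2))
      (proj₁ lower) (proj₁ upper) (proj₂ lower)
      (λ eq → turn (pp 1) (pp 2) (p≉p 1) (trans eq (hue-sym (pp 2))))
      (turn (pp 1) e₂ (p≉q 1))
      (turn (~-sym (pp 2)) e₂ (q≉p 2 ∘ ≈ᵛ.sym))
    where
    lower = hexagon (pp 0) (pp 1) e₂ (~-sym (qq 1)) (~-sym (qq 0)) (~-sym e₀)
      (p≉p 0) (p≉q 1) (q≉p 1 ∘ ≈ᵛ.sym) (q≉q 0 ∘ ≈ᵛ.sym) (p≉q 0 ∘ ≈ᵛ.sym)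
    upper = hexagon (~-sym (pp 3)) (~-sym (pp 2)) e₂ (qq 2) (qq 3) (~-sym e₄)
      (p≉p 2 ∘ ≈ᵛ.sym) (q≉p 2 ∘ ≈ᵛ.sym) (p≉q 2) (q≉q 2) (q≉p 3)

    three-colours : ∀ (i j k : Fin 3) → i ≢ 1F → j ≢ 1F → k ≢ 1F → i ≢ j → i ≢ k → ¬ (j ≢ k)
    three-colours = from-yes (all? {3} λ i → all? {3} λ j → all? {3} λ k → ¬? (i ≟ 1F) →-dec ¬? (j ≟ 1F) →-dec ¬? (k ≟ 1F) →-dec
      ¬? (i ≟ j) →-dec ¬? (i ≟ k) →-dec ¬? (¬? (j ≟ k)))

-- Honeycomb toroidal graphs

⊕-suc : ∀ {n} (i : Fin n) t → (i ⊕ t) ⊕ 1 ≡ i ⊕ suc t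
⊕-suc i t = trans (⊕-assoc i t 1) (cong (i ⊕_) (+-comm t 1))

⊕-shift-≢ : ∀ {n} (i : Fin n) t {d} → 0 < d → d < n → i ⊕ t ≢ i ⊕ (t + d)
⊕-shift-≢ i t {d} 0<d d<n eq = ⊕-moves (i ⊕ t) 0<d d<n (trans (⊕-assoc i t d) (sym eq))

⊕-parity : ∀ {n} → 2 ∣ n → (i : Fin n) → ∀ t → toℕ (i ⊕ t) ≡₂ toℕ i + t
⊕-parity {n@(suc _)} 2∣n i t = trans (cong (_% 2) (toℕ-⊕ i t)) (m∣n⇒o%n%m≡o%m 2 n (toℕ i + t) 2∣n)

module _ {m : ℕ} where

  X≇HTG-columns : ∀ {m′ n ℓ} → 2 ∣ n → 4 ≤ n → ¬ (X (3 * m) ≅ HTG (suc (suc m′)) n ℓ)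
  X≇HTG-columns {n = 1} _ (s≤s ())
  X≇HTG-columns {m′} {n@(suc (suc _))} {ℓ} 2∣n 4≤n φ = no-ladder (at 0F) (at 1F) (vertical-edge 0F) (vertical-edge 1F)
    (rung 0 (sym (⊕-parity 2∣n base 0))) (rung 2 (sym (⊕-parity 2∣n base 2))) (rung 4 (sym (⊕-parity 2∣n base 4)))
    (apart 0F) (apart 1F) (λ t ()) (λ t ())
    where
    open Transport m φ
    open Graph (HTG (suc (suc m′)) n ℓ)

    base : Fin n
    -- Columns 0 and 1 are joined at odd heights, so starting at height 1 puts the rungs at even
    -- `t`. Heights are cyclic: for `n = 4` the first and last rungs coincide.
    base = 1F

    at : Fin (suc (suc m′)) → ℕ → V
    at i t = i , base ⊕ t

    vertical-edge : ∀ i t → at i t ~ at i (suc t)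
    vertical-edge i t =
        (λ eq → ⊕-moves (base ⊕ t) (s≤s z≤n) (s≤s (s≤s z≤n)) (trans (⊕-suc base t) (sym (,-injectiveʳ eq))))
      , vertical i (base ⊕ t) , inj₁ (refl , cong (i ,_) (sym (⊕-suc base t)))

    apart : ∀ i t → at i t ≢ at i (2 + t)
    apart i t eq = ⊕-shift-≢ base t {2} (s≤s z≤n) (≤-trans (s≤s (s≤s (s≤s z≤n))) 4≤n)
      (trans (,-injectiveʳ eq) (cong (base ⊕_) (+-comm 2 t)))

    rung : ∀ t → 1 ≡₂ toℕ (base ⊕ t) → at 0F t ~ at 1F t
    rung t odd = (λ ()) , horizontal 0F 1F (base ⊕ t) refl odd , inj₁ (refl , refl)

  -- Parity excludes `ℓ = 0`. For `ℓ = 1` the jumps coincide with vertical edges and every degree is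
  -- two. For larger `ℓ` the column and its own shift by `ℓ` form the two sides of a ladder, with
  -- jumps as rungs.
  X≇HTG-single : ∀ {n ℓ} → 2 ∣ n → 4 ≤ n → 2 * ℓ ≤ n → ℓ ≡₂ 1 → ¬ (X (3 * m) ≅ HTG 1 n ℓ)
  X≇HTG-single {ℓ = 0} _ _ _ ()
  X≇HTG-single {1} {suc _} _ (s≤s ())
  X≇HTG-single {n@(suc (suc _))} {1} _ _ _ _ φ =
    no-degree-two (0F , 0F) (0F , 0F ⊕ 1) (0F , 0F ⊕ (n ∸ 1)) λ y (_ , e , joins) → neighbour y e joins
    where
    open Transport m φ

    previous : ∀ (j : Fin n) → 0F ≡ j ⊕ 1 → j ≡ 0F ⊕ (n ∸ 1)
    previous j eq = sym (trans (cong (_⊕ (n ∸ 1)) eq) (trans (⊕-assoc j 1 (n ∸ 1)) (⊕-multiple j ∣-refl)))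

    neighbour : ∀ y (e : HTGEdge 1 n) → _ → y ≡ (0F , 0F ⊕ 1) ⊎ y ≡ (0F , 0F ⊕ (n ∸ 1))
    neighbour y (vertical 0F j)       (inj₁ (p , q)) = inj₁ (trans q (cong (λ i → 0F , i ⊕ 1) (sym (,-injectiveʳ p))))
    neighbour y (vertical 0F j)       (inj₂ (p , q)) = inj₂ (trans q (cong (0F ,_) (previous j (,-injectiveʳ p))))
    neighbour y (horizontal 0F 0F _ () _)
    neighbour y (jump 0F 0F j _ _ _)  (inj₁ (p , q)) = inj₁ (trans q (cong (λ i → 0F , i ⊕ 1) (sym (,-injectiveʳ p))))
    neighbour y (jump 0F 0F j _ _ _)  (inj₂ (p , q)) = inj₂ (trans q (cong (0F ,_) (previous j (,-injectiveʳ p))))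
  X≇HTG-single {n@(suc (suc _))} {ℓ@(suc (suc l))} 2∣n 4≤n 2ℓ≤n _ φ = no-ladder at (λ t → at (t + ℓ)) edge (λ t → edge (t + ℓ))
    (rung 0 (⊕-parity 2∣n base 0)) (rung 2 (⊕-parity 2∣n base 2)) (rung 4 (⊕-parity 2∣n base 4))
    apart (λ t → apart (t + ℓ))
    (λ t eq → shift t (s≤s z≤n) 1+ℓ<n (trans eq (cong at (sym (+-suc t ℓ)))))
    (λ t eq → shift (suc t) {suc l} (s≤s z≤n) (<-trans (n<1+n (suc l)) ℓ<n) (sym (trans (cong at (sym (+-suc t (suc l)))) eq)))
    where
    open Transport m φ
    open Graph (HTG 1 n ℓ)

    -- Here `2 ≤ ℓ` and `2 * ℓ ≤ n`. The bound separates a vertex on one side from the vertex one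
    -- step further on the other.
    1+ℓ<n : suc ℓ < n
    1+ℓ<n = begin
      2 + ℓ        ≤⟨ +-monoˡ-≤ ℓ (s≤s (s≤s (z≤n {l}))) ⟩
      ℓ + ℓ        ≡⟨ cong (ℓ +_) (+-identityʳ ℓ) ⟨
      2 * ℓ        ≤⟨ 2ℓ≤n ⟩
      n            ∎
      where open ≤-Reasoning

    ℓ<n : ℓ < n
    ℓ<n = <-trans (n<1+n ℓ) 1+ℓ<n

    base : Fin n
    base = 1F

    at : ℕ → V
    at t = 0F , base ⊕ t

    shift : ∀ t {d} → 0 < d → d < n → at t ≢ at (t + d)
    shift t 0<d d<n eq = ⊕-shift-≢ base t 0<d d<n (,-injectiveʳ eq)

    edge : ∀ t → at t ~ at (suc t)
    edge t = (λ eq → shift t {1} (s≤s z≤n) (s≤s (s≤s z≤n)) (trans eq (cong at (+-comm 1 t))))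
           , vertical 0F (base ⊕ t) , inj₁ (refl , cong (0F ,_) (sym (⊕-suc base t)))

    apart : ∀ t → at t ≢ at (2 + t)
    apart t eq = shift t {2} (s≤s z≤n) (≤-trans (s≤s (s≤s (s≤s z≤n))) 4≤n) (trans eq (cong at (+-comm 2 t)))

    rung : ∀ t → toℕ (base ⊕ t) ≡₂ 1 → at t ~ at (t + ℓ)
    rung t odd = shift t (s≤s z≤n) ℓ<n
               , jump 0F 0F (base ⊕ t) refl refl odd , inj₁ (refl , cong (0F ,_) (sym (⊕-assoc base t ℓ)))

  X≇HTG : ∀ m′ n ℓ → 1 ≤ m′ → 2 ∣ n → 4 ≤ n → 2 * ℓ ≤ n → ℓ ≡₂ m′ → ¬ (X (3 * m) ≅ HTG m′ n ℓ)
  X≇HTG (suc zero)     n ℓ _ 2∣n 4≤n 2ℓ≤n ℓ≡m′ = X≇HTG-single 2∣n 4≤n 2ℓ≤n ℓ≡m′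
  X≇HTG (suc (suc m′)) n ℓ _ 2∣n 4≤n _    _    = X≇HTG-columns 2∣n 4≤n

-- Generalized Petersen graphs

GP-cardinality : ∀ n → HasCardinality (≡.setoid (GPVertex n)) (n + n)
GP-cardinality n = mk↔ₛ′ from⊎ to⊎ (λ { (u i) → refl ; (v i) → refl }) (λ { (inj₁ i) → refl ; (inj₂ i) → refl }) ↔-∘ +↔⊎
  where
  from⊎ : Fin n ⊎ Fin n → GPVertex n
  from⊎ (inj₁ i) = u i
  from⊎ (inj₂ i) = v i
  to⊎ : GPVertex n → Fin n ⊎ Fin n
  to⊎ (u i) = inj₁ i
  to⊎ (v i) = inj₂ i

iso-cardinality : ∀ {G H k} → G ≅ H → HasOrder G k → HasOrder H k
iso-cardinality φ I = Composition.inverse I (_≅_.bijection φ)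

order-injective : ∀ {G H j k} → G ≅ H → HasOrder G j → HasOrder H k → j ≡ k
order-injective φ I J = cardinality-unique (iso-cardinality φ I) J

not-1 : ∀ (c : Fin 3) → c ≢ 1F → c ≡ 0F ⊎ c ≡ 2F
not-1 0F _  = inj₁ refl
not-1 1F ≢1 = contradiction refl ≢1
not-1 2F _  = inj₂ refl

module GPIsomorphic (m n k : ℕ) (1≤m : 1 ≤ m) (1≤k : 1 ≤ k) (2k≤n : 2 * k ≤ n) (φ : X (3 * m) ≅ GP n k) where
  private
    module D = Group (D (3 * m))
    module G = Group (S₃×D (3 * m))
  open Transport m φ
  open Graph (GP n k)

  n≡18m : n ≡ 18 * m
  n≡18m = *-cancelˡ-≡ n (18 * m) 2 (begin
    2 * n         ≡⟨ cong (n +_) (+-identityʳ n) ⟩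
    n + n         ≡⟨ order-injective φ (X-order m 1≤m) (GP-cardinality n) ⟨
    36 * m        ≡⟨ *-assoc 2 18 m ⟩
    2 * (18 * m)  ∎)
    where open ≡-Reasoning

  -- Ensures that `6m` steps do not complete the outer cycle, so returning after them is a
  -- contradiction.
  6m<n : m * 6 < n
  6m<n = subst (m * 6 <_) (trans (*-comm m 18) (sym n≡18m)) (*-monoʳ-< m ⦃ >-nonZero 1≤m ⦄ (from-yes (7 ≤? 18)))

  2<n : 2 < n
  2<n = ≤-trans (from-yes (3 ≤? 18)) (subst (18 ≤_) (sym n≡18m) (*-monoʳ-≤ 18 1≤m))

  base : Fin n
  base = fromℕ< (≤-trans (s≤s z≤n) 2<n)

  outer-vertex inner-vertex : ℕ → V
  outer-vertex t = u (base ⊕ t)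
  inner-vertex t = v (base ⊕ t)

  u-injective : ∀ {i j : Fin n} → u i ≡ u j → i ≡ j
  u-injective refl = refl

  v-injective : ∀ {i j : Fin n} → v i ≡ v j → i ≡ j
  v-injective refl = refl

  k<n : k < n
  k<n = ≤-trans (subst (k <_) (sym (cong (k +_) (+-identityʳ k))) (m<m+n k 1≤k)) 2k≤n

  -- If `n = 2k`, the inner edges starting at `vᵢ` and at `vᵢ₊ₖ` are the same, which leaves inner
  -- vertices with degree two.
  2k≢n : k + k ≢ n
  2k≢n k+k≡n = no-degree-two (v base) (u base) (v (base ⊕ k)) λ y (_ , e , joins) → neighbour y e joins
    where
    opposite : ∀ i → base ≡ i ⊕ k → i ≡ base ⊕ k
    opposite i eq = sym (trans (cong (_⊕ k) eq) (trans (⊕-assoc i k k)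
      (⊕-multiple i (subst (n ∣_) (sym k+k≡n) ∣-refl))))

    neighbour : ∀ y (e : GPEdge n) → _ → y ≡ u base ⊎ y ≡ v (base ⊕ k)
    neighbour y (outer i) (inj₁ (() , _))
    neighbour y (outer i) (inj₂ (() , _))
    neighbour y (spoke i) (inj₁ (() , _))
    neighbour y (spoke i) (inj₂ (p , q)) = inj₁ (trans q (cong u (sym (v-injective p))))
    neighbour y (inner i) (inj₁ (p , q)) = inj₂ (trans q (cong (λ j → v (j ⊕ k)) (sym (v-injective p))))
    neighbour y (inner i) (inj₂ (p , q)) = inj₂ (trans q (cong v (opposite i (v-injective p))))

  2k<n : k + k < n
  2k<n = ≤∧≢⇒< (subst (_≤ n) (cong (k +_) (+-identityʳ k)) 2k≤n) 2k≢n

  outer-edge : ∀ t → outer-vertex t ~ outer-vertex (suc t)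
  outer-edge t = (λ eq → ⊕-shift-≢ base t {1} (s≤s z≤n) (<-trans (s≤s (s≤s z≤n)) 2<n) (trans (u-injective eq) (cong (base ⊕_) (+-comm 1 t))))
               , outer (base ⊕ t) , inj₁ (refl , cong u (sym (⊕-suc base t)))

  spoke-edge : ∀ t → outer-vertex t ~ inner-vertex t
  spoke-edge t = (λ ()) , spoke (base ⊕ t) , inj₁ (refl , refl)

  inner-edge : ∀ t → inner-vertex t ~ inner-vertex (t + k)
  inner-edge t = (λ eq → ⊕-shift-≢ base t 1≤k k<n (v-injective eq))
               , inner (base ⊕ t) , inj₁ (refl , cong v (sym (⊕-assoc base t k)))

  o s τ : ℕ → Fin 3
  o t = hue (outer-vertex t) (outer-vertex (suc t))
  s t = hue (outer-vertex t) (inner-vertex t)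
  τ t = hue (inner-vertex t) (inner-vertex (t + k))

  o≢s : ∀ t → o t ≢ s t
  o≢s t eq = contradiction (hue-injective (outer-edge t) (spoke-edge t) eq) λ ()

  o≢s-suc : ∀ t → o t ≢ s (suc t)
  o≢s-suc t = turn (outer-edge t) (spoke-edge (suc t)) (λ ())

  s≢τ : ∀ t → s t ≢ τ t
  s≢τ t = turn (spoke-edge t) (inner-edge t) (λ ())

  τ≢s+k : ∀ t → τ t ≢ s (t + k)
  τ≢s+k t eq = turn (inner-edge t) (~-sym (spoke-edge (t + k))) (λ ()) (trans eq (sym (hue-sym (spoke-edge (t + k)))))

  o≢o-suc : ∀ t → o t ≢ o (suc t)
  o≢o-suc t = turn (outer-edge t) (outer-edge (suc t)) λ eq →
    ⊕-shift-≢ base t {2} (s≤s z≤n) 2<n (trans (u-injective eq) (cong (base ⊕_) (+-comm 2 t)))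

  τ≢τ+k : ∀ t → τ t ≢ τ (t + k)
  τ≢τ+k t = turn (inner-edge t) (inner-edge (t + k)) λ eq →
    ⊕-shift-≢ base t {k + k} (≤-trans 1≤k (m≤m+n k k)) 2k<n (trans (v-injective eq) (cong (base ⊕_) (+-assoc t k k)))

  octagon : ℕ → ColourWord 8
  octagon t = o t ∷ s (suc t) ∷ τ (suc t) ∷ s (suc t + k) ∷ o (t + k) ∷ s (t + k) ∷ τ t ∷ s t ∷ []

  -- For `k = 1` this walk repeats vertices and is not a cycle, but the argument uses only that it
  -- is closed and changes colour at each step.
  octagon-walk : ∀ t → Walk (outer-vertex t) (octagon t) (outer-vertex t)
  octagon-walk t =
    step (outer-edge t) ∷ step (spoke-edge (suc t)) ∷ step (inner-edge (suc t)) ∷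
    step-back (spoke-edge (suc t + k)) ∷ step-back (outer-edge (t + k)) ∷ step (spoke-edge (t + k)) ∷
    step-back (inner-edge t) ∷ step-back (spoke-edge t) ∷ []

  octagon-reduced : ∀ t → Reduced (octagon t)
  octagon-reduced t =
    o≢s-suc t ∷ s≢τ (suc t) ∷ τ≢s+k (suc t) ∷ o≢s-suc (t + k) ∘ sym ∷
    o≢s (t + k) ∷ τ≢s+k t ∘ sym ∷ s≢τ t ∘ sym ∷ [-]

  octagon-octagon : ∀ t → IsOctagon (octagon t)
  octagon-octagon t = o≢s t , closed {w = octagon t} (octagon-walk t)

  octagon-◁ : ∀ t → octagon t ◁ octagon (suc t)
  octagon-◁ t = o≢o-suc t , o≢o-suc (t + k) , refl , refl , refl

  octagon-△ : ∀ t → octagon t △ octagon (t + k)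
  octagon-△ t = τ≢τ+k t , τ≢τ+k (suc t) , refl , refl , refl

  spoke-colour : ∀ t → s t ≡ 1F
  spoke-colour t = block-spoke
    (octagon t) (octagon-reduced t) (octagon-octagon t)
    (octagon (suc t)) (octagon-reduced (suc t)) (octagon-◁ t) (octagon-octagon (suc t))
    (octagon (t + k)) (octagon-reduced (t + k)) (octagon-△ t) (octagon-octagon (t + k))
    (octagon (suc t + k)) (octagon-reduced (suc t + k)) (octagon-△ (suc t)) (octagon-octagon (suc t + k))

  o≢1 : ∀ t → o t ≢ 1F
  o≢1 t eq = o≢s t (trans eq (sym (spoke-colour t)))

  o-alternates : ∀ t → o (suc (suc t)) ≡ o t
  o-alternates t = alternate (o t) (o (suc t)) (o (2 + t)) (o≢1 t) (o≢1 (suc t)) (o≢1 (2 + t)) (o≢o-suc t) (o≢o-suc (suc t))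
    where
    alternate : ∀ (x y w : Fin 3) → x ≢ 1F → y ≢ 1F → w ≢ 1F → x ≢ y → y ≢ w → w ≡ x
    alternate = from-yes (all? {3} λ x → all? {3} λ y → all? {3} λ w →
      ¬? (x ≟ 1F) →-dec ¬? (y ≟ 1F) →-dec ¬? (w ≟ 1F) →-dec ¬? (x ≟ y) →-dec ¬? (y ≟ w) →-dec (w ≟ x))

  -- Fixes the phase, so that the outer cycle is read as `bcbc…` and each pair of steps multiplies
  -- by `bc`.
  start : ∃[ t ] o t ≡ 2F × o (suc t) ≡ 0F
  start = choose (not-1 (o 0) (o≢1 0)) (not-1 (o 1) (o≢1 1))
    where
    choose : o 0 ≡ 0F ⊎ o 0 ≡ 2F → o 1 ≡ 0F ⊎ o 1 ≡ 2F → ∃[ t ] o t ≡ 2F × o (suc t) ≡ 0F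
    choose (inj₂ o₀≡b) (inj₁ o₁≡c) = 0 , o₀≡b , o₁≡c
    choose (inj₁ o₀≡c) (inj₂ o₁≡b) = 1 , o₁≡b , trans (o-alternates 0) o₀≡c
    choose (inj₁ o₀≡c) (inj₁ o₁≡c) = contradiction (trans o₀≡c (sym o₁≡c)) (o≢o-suc 0)
    choose (inj₂ o₀≡b) (inj₂ o₁≡b) = contradiction (trans o₀≡b (sym o₁≡b)) (o≢o-suc 0)

  σ : ℕ → Permutation′ 3
  σ t = proj₁ (position (outer-vertex t))

  δ : ℕ → Presentation.Word DihedralGen
  δ t = proj₂ (position (outer-vertex t))

  module _ (b : ℕ) (o-b : o b ≡ 2F) (o-b+1 : o (suc b) ≡ 0F) where

    at : ℕ → ℕ
    -- In this order `at (suc j)` computes to `suc (suc (at j))`.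
    at j = j * 2 + b

    o-even : ∀ j → o (at j) ≡ 2F
    o-even zero    = o-b
    o-even (suc j) = trans (o-alternates (at j)) (o-even j)

    o-odd : ∀ j → o (suc (at j)) ≡ 0F
    o-odd zero    = o-b+1
    o-odd (suc j) = trans (o-alternates (suc (at j))) (o-odd j)

    step-even : ∀ j → position (outer-vertex (suc (at j))) G.≈ position (outer-vertex (at j)) G.∙ generator 2F
    step-even j = subst (λ l → position (outer-vertex (suc (at j))) G.≈ position (outer-vertex (at j)) G.∙ generator l)
      (o-even j) (step (outer-edge (at j)))

    step-odd : ∀ j → position (outer-vertex (at (suc j))) G.≈ position (outer-vertex (suc (at j))) G.∙ generator 0F
    step-odd j = subst (λ l → position (outer-vertex (at (suc j))) G.≈ position (outer-vertex (suc (at j))) G.∙ generator l)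
      (o-odd j) (step (outer-edge (suc (at j))))

    z∙zr≈r : zᴰ D.∙ zrᴰ D.≈ rᴰ
    z∙zr≈r = D.trans (D.sym (D.assoc zᴰ zᴰ rᴰ)) (D.trans (D.∙-congʳ (CayleyX.dihedralPart-involutive 2F)) (D.identityˡ rᴰ))

    δ-double : ∀ j → δ (at (suc j)) D.≈ δ (at j) D.∙ rᴰ
    δ-double j = begin
      δ (at (suc j))                ≈⟨ proj₂ (step-odd j) ⟩
      δ (suc (at j)) D.∙ zrᴰ        ≈⟨ D.∙-congʳ (proj₂ (step-even j)) ⟩
      (δ (at j) D.∙ zᴰ) D.∙ zrᴰ     ≈⟨ D.assoc (δ (at j)) zᴰ zrᴰ ⟩
      δ (at j) D.∙ (zᴰ D.∙ zrᴰ)     ≈⟨ D.∙-congˡ z∙zr≈r ⟩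
      δ (at j) D.∙ rᴰ               ∎
      where open import Relation.Binary.Reasoning.Setoid D.setoid

    open Presentation DihedralGen using (_^_)

    δ-power : ∀ j → δ (at j) D.≈ δ b D.∙ rᴰ ^ j
    δ-power zero    = D.sym (D.identityʳ (δ b))
    δ-power (suc j) = begin
      δ (at (suc j))              ≈⟨ δ-double j ⟩
      δ (at j) D.∙ rᴰ             ≈⟨ D.∙-cong (δ-power j) (D.sym (D.identityʳ rᴰ)) ⟩
      (δ b D.∙ rᴰ ^ j) D.∙ rᴰ ^ 1 ≈⟨ D.assoc (δ b) (rᴰ ^ j) (rᴰ ^ 1) ⟩
      δ b D.∙ (rᴰ ^ j D.∙ rᴰ ^ 1) ≈⟨ D.∙-congˡ (^-+ rᴰ j 1) ⟨
      δ b D.∙ rᴰ ^ (j + 1)        ≡⟨ cong (λ e → δ b D.∙ rᴰ ^ e) (+-comm j 1) ⟩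
      δ b D.∙ rᴰ ^ suc j          ∎
      where open import Relation.Binary.Reasoning.Setoid D.setoid

    σ-double : ∀ j i → σ (at (suc j)) ⟨$⟩ʳ i ≡ σ (at j) ⟨$⟩ʳ (transposition 2F ⟨$⟩ʳ (transposition 0F ⟨$⟩ʳ i))
    σ-double j i = trans (proj₁ (step-odd j) i) (proj₁ (step-even j) _)

    bc : Fin 3 → Fin 3
    bc i = transposition 2F ⟨$⟩ʳ (transposition 0F ⟨$⟩ʳ i)

    bc-cubed : ∀ i → bc (bc (bc i)) ≡ i
    bc-cubed = from-yes (all? λ i → bc (bc (bc i)) ≟ i)

    σ-period : ∀ j i → σ (at (j * 3)) ⟨$⟩ʳ i ≡ σ b ⟨$⟩ʳ i
    σ-period zero    i = refl
    σ-period (suc j) i = begin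
      σ (at (3 + j * 3)) ⟨$⟩ʳ i              ≡⟨ σ-double (2 + j * 3) i ⟩
      σ (at (2 + j * 3)) ⟨$⟩ʳ bc i           ≡⟨ σ-double (1 + j * 3) (bc i) ⟩
      σ (at (1 + j * 3)) ⟨$⟩ʳ bc (bc i)      ≡⟨ σ-double (j * 3) (bc (bc i)) ⟩
      σ (at (j * 3)) ⟨$⟩ʳ bc (bc (bc i))     ≡⟨ cong (σ (at (j * 3)) ⟨$⟩ʳ_) (bc-cubed i) ⟩
      σ (at (j * 3)) ⟨$⟩ʳ i                  ≡⟨ σ-period j i ⟩
      σ b ⟨$⟩ʳ i                             ∎
      where open ≡-Reasoning

    -- After `3m` pairs `bc` the permutation part is restored because `bc` acts as a 3-cycle, and
    -- the dihedral part because it has gained `r` to the power `3m`.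
    returns : outer-vertex (at (m * 3)) ≡ outer-vertex b
    returns = position-injective (σ-period m , D.trans (δ-power (m * 3)) (D.trans (D.∙-congˡ r^3m≈ε) (D.identityʳ (δ b))))
      where
      r^3m≈ε : rᴰ ^ (m * 3) D.≈ D.ε
      r^3m≈ε = subst (λ e → rᴰ ^ e D.≈ D.ε) (*-comm 3 m) (Presentation.relator rⁿ)

    absurd : Empty
    absurd = ⊕-shift-≢ base b {m * 6} (≤-trans 1≤m (m≤m*n m 6)) 6m<n
      (trans (sym (u-injective returns)) (cong (base ⊕_) (trans (cong (_+ b) (*-assoc m 3 2)) (+-comm (m * 6) b))))

  contradictory : Empty
  contradictory = let b , o-b , o-b+1 = start in absurd b o-b o-b+1

corollary4p8 : (∀ m → 1 ≤ m →
    VertexTransitive (X (3 * m))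
    × Is3RDR (X (3 * m))
    × HasOrder (X (3 * m)) (36 * m)
    × (∀ m′ n ℓ → 1 ≤ m′ → 2 ∣ n → 4 ≤ n → 2 * ℓ ≤ n → ℓ ≡₂ m′ → ¬ (X (3 * m) ≅ HTG m′ n ℓ))
    × (∀ n k → 1 ≤ k → 2 * k ≤ n → ¬ (X (3 * m) ≅ GP n k)))
    × (∀ m m′ → 1 ≤ m → 1 ≤ m′ → X (3 * m) ≅ X (3 * m′) → m ≡ m′)
corollary4p8 =
    (λ m 1≤m →
        CayleyX.X-vertexTransitive
      , X-3RDR m 1≤m
      , X-order m 1≤m
      , X≇HTG {m}
      , λ n k 1≤k 2k≤n φ → GPIsomorphic.contradictory m n k 1≤m 1≤k 2k≤n φ)
  -- The family is infinite because the orders `36m` differ.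
  , λ m m′ 1≤m 1≤m′ φ → *-cancelˡ-≡ m m′ 36 (order-injective φ (X-order m 1≤m) (X-order m′ 1≤m′))
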